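{- ${\rm fasd}(3,g)=g$ for every $g\in\{3,4,5\}$.
   Context: An oriented graph is a digraph without loops, multiple arcs or directed $2$-cycles. Degree of a vertex = in-degree + out-degree; directed girth = minimum length of a directed cycle ($\infty$ if none). A feedback arc set is a set $F$ of arcs whose removal leaves an acyclic digraph. For a digraph $D$, ${\rm fasd}(D)$ is the maximum number $t$ such that $A(D)$ can be partitioned into $t$ feedback arc sets ($\infty$ if $D$ is acyclic). ${\rm fasd}(\Delta,g)$ is the minimum of ${\rm fasd}(D)$ over all oriented graphs $D$ with maximum degree at most $\Delta$ and directed girth at least $g$. -}

module Defs where

open import Data.Nat using (ℕ; zero; suc; _+_; _≤_)
open import Data.Nat.DivMod using (_%_; m%n<n)
open import Data.Fin using (Fin; toℕ; fromℕ<) renaming (_≟_ to _≟ᶠ_)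
open import Data.List using (List; length; filter)
open import Data.List.Base using (allFin)
open import Data.Product using (Σ; _×_; _,_)
open import Data.Empty using (⊥)
open import Data.Unit using (⊤)
open import Function.Definitions using (Injective)
open import Relation.Nullary using (¬_)
open import Relation.Binary.PropositionalEquality using (_≡_; _≢_)

record Digraph : Set where
  field
    n    : ℕ
    m    : ℕ
    tail : Fin m → Fin n
    head : Fin m → Fin n
open Digraph public

record Oriented (D : Digraph) : Set where
  field
    noLoop  : ∀ a → tail D a ≢ head D a
    noMulti : ∀ a b → tail D a ≡ tail D b → head D a ≡ head D b → a ≡ b
    no2cyc  : ∀ a b → tail D a ≡ head D b → head D a ≡ tail D b → ⊥

outdeg indeg deg : (D : Digraph) → Fin (n D) → ℕ
outdeg D v = length (filter (λ a → tail D a ≟ᶠ v) (allFin (m D)))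
indeg  D v = length (filter (λ a → head D a ≟ᶠ v) (allFin (m D)))
deg D v = indeg D v + outdeg D v

MaxDegreeAtMost : ℕ → Digraph → Set
MaxDegreeAtMost Δ D = ∀ v → deg D v ≤ Δ

next : ∀ {k} → Fin (suc k) → Fin (suc k)
next {k} i = fromℕ< (m%n<n (suc (toℕ i)) (suc k))

record CycleIn (D : Digraph) (P : Fin (m D) → Set) (k : ℕ) : Set where
  field
    v     : Fin (suc k) → Fin (n D)
    vInj  : Injective _≡_ _≡_ v
    c     : Fin (suc k) → Fin (m D)
    cTail : ∀ i → tail D (c i) ≡ v i
    cHead : ∀ i → head D (c i) ≡ v (next i)
    cP    : ∀ i → P (c i)


GirthAtLeast : ℕ → Digraph → Set
GirthAtLeast g D = ∀ k → CycleIn D (λ _ → ⊤) k → g ≤ suc k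

FeedbackArcSet : (D : Digraph) → (Fin (m D) → Set) → Set
FeedbackArcSet D F = ∀ k → ¬ CycleIn D (λ a → ¬ F a) k

PartitionFAS : (D : Digraph) → ℕ → Set
PartitionFAS D t = Σ (Fin (m D) → Fin t) λ col →
  ∀ s → FeedbackArcSet D (λ a → col a ≡ s)

-- fasd(D) ≥ t  (includes fasd(D) = ∞)
FasdAtLeast : Digraph → ℕ → Set
FasdAtLeast D t = PartitionFAS D t

FasdEq : Digraph → ℕ → Set
FasdEq D t = PartitionFAS D t × (∀ s → PartitionFAS D s → s ≤ t)

-- the class of oriented graphs over which fasd(Δ,g) minimises
Admissible : ℕ → ℕ → Digraph → Set
Admissible Δ g D = Oriented D × MaxDegreeAtMost Δ D × GirthAtLeast g D

FasdΔgEq : ℕ → ℕ → ℕ → Set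
FasdΔgEq Δ g t = (∀ D → Admissible Δ g D → FasdAtLeast D t)
               × Σ Digraph (λ D → Admissible Δ g D × FasdEq D t)

{-# OPTIONS --safe #-}

-- A partition into g feedback arc sets is a g-colouring of the arcs in which every directed cycle meets
-- every colour.  For the upper bound, the directed g-cycle admits no more than g colours.  For the lower
-- bound, delete arcs lying on no cycle until there is a root arc r : b → a that is the only arc out of b
-- and the only arc into a.  Let e₁, e₂ be the arcs into b, with tails x₁, x₂, and f₁, f₂ the arcs out
-- of a, with heads y₁, y₂.  Colour the digraph without a and b inductively; a new cycle passes through
-- some xᵢ eᵢ b r a fⱼ yⱼ.  For g = 3 give the eᵢ, r, fⱼ three different colours.
-- In the smaller digraph xᵢ and yⱼ have degree at most 2, so on a cycle they have a unique in-arc and a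
-- unique out-arc, whose colours may be swapped.  For g = 4 the in-arc of xᵢ supplies a fourth colour.
-- For g = 5 the out-arc of yⱼ supplies a fifth one, as soon as the colours before the xᵢ are disjoint
-- from those after the yⱼ.  A swap at xᵢ avoids the two colours Y after y₁, y₂ unless the arcs at xᵢ
-- have exactly these two colours; and if Y cannot be reduced to one colour, then swaps at y₁ or y₂ yield
-- three different candidates for Y, of which each of x₁, x₂ forbids at most one.
module Submission where

open import Defs
open import Data.Nat using (ℕ; zero; suc; _+_; _≤_; _<_; z≤n; s≤s)
open import Data.Nat.DivMod using (_%_; m%n<n; m%n%n≡m%n; [m+n]%n≡m%n; m<n⇒m%n≡m; %-distribˡ-+)
import Data.Nat.Properties as ℕ
open import Data.Nat.Induction using (<-wellFounded)
open import Induction.WellFounded using (Acc; acc)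
open import Data.Fin using (Fin; zero; suc; toℕ; fromℕ<)
open import Data.Fin.Properties using (_≟_; any?; all?; ¬∀⟶∃¬; injective⇒≤; toℕ-injective; toℕ-fromℕ<; toℕ<n)
open import Data.List using (List; []; _∷_; length; filter; lookup; allFin)
open import Data.List.Properties using (filter-notAll)
open import Data.List.Membership.Propositional using (_∈_; _∉_; lose)
open import Data.List.Membership.Propositional.Properties using (∈-filter⁺; ∈-filter⁻; ∈-allFin; ∈-lookup)
open import Data.List.Relation.Unary.Any as Any using (here; there)
open import Data.List.Relation.Unary.All as All using (All; []; _∷_)
open import Data.List.Relation.Unary.AllPairs using ([]; _∷_)
open import Data.List.Relation.Unary.Unique.Propositional using (Unique)
open import Data.List.Relation.Binary.Subset.Propositional using (_⊆_)
open import Data.Product using (∃; _×_; _,_; proj₁; proj₂)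
open import Data.Sum using (_⊎_; inj₁; inj₂)
open import Data.Empty using (⊥; ⊥-elim)
open import Data.Unit using (⊤; tt)
open import Function using (_∘_; id)
open import Function.Definitions using (Injective)
open import Relation.Nullary using (¬_; Dec; yes; no)
open import Relation.Nullary.Decidable using (_×-dec_; _⊎-dec_; ¬?; decidable-stable; from-yes)
open import Relation.Unary using (Decidable)
open import Relation.Binary.PropositionalEquality using (_≡_; _≢_; refl; sym; trans; cong; subst; subst₂; module ≡-Reasoning)

-- Counting in lists and finite sets

module _ {A : Set} where

  index-injective : {x y : A} {xs : List A} (p : x ∈ xs) (q : y ∈ xs) → Any.index p ≡ Any.index q → x ≡ y
  index-injective (here refl) (here refl) _  = refl
  index-injective (there p)   (there q)   eq = index-injective p q (suc-injective eq)
    where open import Data.Fin.Properties using (suc-injective)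

  lookup-injective : {xs : List A} → Unique xs → Injective _≡_ _≡_ (lookup xs)
  lookup-injective (_ ∷ _)  {zero}  {zero}  _  = refl
  lookup-injective (d ∷ _)  {zero}  {suc j} eq = ⊥-elim (All.lookup d (∈-lookup j) eq)
  lookup-injective (d ∷ _)  {suc i} {zero}  eq = ⊥-elim (All.lookup d (∈-lookup i) (sym eq))
  lookup-injective (_ ∷ us) {suc i} {suc j} eq = cong suc (lookup-injective us eq)

  unique-⊆⇒length≤ : {xs ys : List A} → Unique xs → xs ⊆ ys → length xs ≤ length ys
  unique-⊆⇒length≤ u sub = injective⇒≤ λ {i} {j} eq →
    lookup-injective u (index-injective (sub (∈-lookup i)) (sub (∈-lookup j)) eq)

module _ {k : ℕ} where

  open import Data.List.Membership.DecPropositional (_≟_ {k}) using (_∈?_)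

  fresh : (xs : List (Fin k)) → length xs < k → ∃ λ c → c ∉ xs
  fresh xs short = ¬∀⟶∃¬ k (_∈ xs) (_∈? xs) λ all →
    ℕ.<⇒≱ short (injective⇒≤ λ {c} {d} → index-injective (all c) (all d))

  -- A missing value could be prepended to `xs`, giving a duplicate-free list of more than `k`
  -- elements of `Fin k`.
  unique-full : {xs : List (Fin k)} → Unique xs → length xs ≡ k → ∀ c → c ∈ xs
  unique-full {xs} u len c with c ∈? xs
  ... | yes p = p
  ... | no  c∉ = ⊥-elim (ℕ.<-irrefl len (injective⇒≤ (lookup-injective
    (All.tabulate (λ d∈ c≡d → c∉ (subst (_∈ xs) (sym c≡d) d∈)) ∷ u))))

  -- A missed value would extend f to an embedding of Fin (suc k) into Fin k.
  injective⇒surjective : {f : Fin k → Fin k} → Injective _≡_ _≡_ f → ∀ y → ∃ λ x → f x ≡ y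
  injective⇒surjective {f} inj y with any? (λ x → f x ≟ y)
  ... | yes p = p
  ... | no ¬p = ⊥-elim (ℕ.<-irrefl refl (injective⇒≤ {f = g} g-inj))
    where
    g : Fin (suc k) → Fin k
    g zero    = y
    g (suc x) = f x
    g-inj : Injective _≡_ _≡_ g
    g-inj {zero}  {zero}  _  = refl
    g-inj {zero}  {suc x} eq = ⊥-elim (¬p (x , sym eq))
    g-inj {suc x} {zero}  eq = ⊥-elim (¬p (x , eq))
    g-inj {suc x} {suc z} eq = cong suc (inj eq)

-- Walks and recolourings

module Walks {n m : ℕ} (tl hd : Fin m → Fin n) where

  data Walk (G : Fin m → Set) : Fin n → Fin n → Set where
    nil  : ∀ {u} → Walk G u u
    cons : ∀ {u w} α → G α → tl α ≡ u → Walk G (hd α) w → Walk G u w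

  -- A closed walk is an arc α followed by a walk from its head back to its tail, hence nonempty.
  Acyclic : (Fin m → Set) → Set
  Acyclic G = ∀ α → G α → Walk G (hd α) (tl α) → ⊥

  module _ {G H : Fin m → Set} where

    map-walk : (∀ {α} → G α → H α) → ∀ {u w} → Walk G u w → Walk H u w
    map-walk f nil            = nil
    map-walk f (cons α g p w) = cons α (f g) p (map-walk f w)

    acyclic-⊆ : (∀ {α} → G α → H α) → Acyclic H → Acyclic G
    acyclic-⊆ f ac α g w = ac α (f g) (map-walk f w)

  _++ʷ_ : ∀ {G u v w} → Walk G u v → Walk G v w → Walk G u w
  nil          ++ʷ w = w
  cons α g p v ++ʷ w = cons α g p (v ++ʷ w)

  module Cut {G : Fin m → Set} (U : Fin n → Set) (U? : Decidable U)
             (closed : ∀ {α} → G α → U (tl α) → U (hd α)) where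

    NotEntering : Fin m → Set
    NotEntering α = G α × (U (tl α) ⊎ ¬ U (hd α))

    stay : ∀ {u w} → Walk G u w → U u → U w
    stay nil               Uu = Uu
    stay (cons α g refl w) Uu = stay w (closed g Uu)

    prune : ∀ {u w} → Walk G u w → U u ⊎ ¬ U w → Walk NotEntering u w
    prune nil               _          = nil
    prune (cons α g refl w) (inj₁ Uu)  = cons α (g , inj₁ Uu) refl (prune w (inj₁ (closed g Uu)))
    prune (cons α g refl w) (inj₂ ¬Uw) = cons α (g , inj₂ (¬Uw ∘ stay w)) refl (prune w (inj₂ ¬Uw))

    -- Since no arc of `G` leaves `U`, a closed walk lies entirely inside or entirely outside `U`,
    -- and so it uses no arc that enters `U`.
    acyclic : Acyclic NotEntering → Acyclic G
    acyclic ac α g w with U? (tl α)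
    ... | yes Ut = ac α (g , inj₁ Ut) (prune w (inj₁ (closed g Ut)))
    ... | no ¬Ut = ac α (g , inj₂ (¬Ut ∘ stay w)) (prune w (inj₂ ¬Ut))

  Avoiding : ∀ {k} → List (Fin m) → (Fin m → Fin k) → Fin k → Fin m → Set
  Avoiding P col c α = α ∈ P × col α ≢ c

  -- Every colour class is a feedback arc set of the subdigraph with arc list `P`. Subdigraphs are
  -- arc lists over the fixed vertex set, so deleting arcs or vertices renames nothing.
  Good : ∀ {k} → List (Fin m) → (Fin m → Fin k) → Set
  Good P col = ∀ c → Acyclic (Avoiding P col c)

  Incident : Fin n → Fin m → Set
  Incident x α = tl α ≡ x ⊎ hd α ≡ x

  module _ {k : ℕ} {P : List (Fin m)} where

    remove-entering : ∀ {Q} (U : Fin n → Set) → Decidable U →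
      (∀ {α} → α ∈ P → U (tl α) → U (hd α)) →
      (∀ {α} → α ∈ P → U (tl α) ⊎ ¬ U (hd α) → α ∈ Q) →
      {col : Fin m → Fin k} → Good Q col → Good P col
    remove-entering U U? closed keep good c =
      Cut.acyclic U U? (λ (α∈ , _) → closed α∈)
        (acyclic-⊆ (λ ((α∈ , α≢) , ne) → keep α∈ ne , α≢) (good c))

    -- In the first two alternatives `x` is a sink or a source among the arcs avoiding `c`, so no
    -- closed walk avoiding `c` uses an arc at `x`, and elsewhere the two colourings agree. In the
    -- third, no new arc avoids `c`.
    recolour-at : ∀ x {col col′ : Fin m → Fin k} → Good P col →
      (∀ α → ¬ Incident x α → col′ α ≡ col α) →
      (∀ c → (∀ α → Avoiding P col′ c α → tl α ≢ x)
           ⊎ (∀ α → Avoiding P col′ c α → hd α ≢ x)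
           ⊎ (∀ α → Avoiding P col′ c α → Avoiding P col c α)) →
      Good P col′
    recolour-at x {col} {col′} good agree how c with how c
    ... | inj₂ (inj₂ incl) = acyclic-⊆ (incl _) (good c)
    ... | inj₁ noOut = Cut.acyclic (_≡ x) (_≟ x) (λ g t → ⊥-elim (noOut _ g t))
          (acyclic-⊆ (λ { (g , inj₁ t) → ⊥-elim (noOut _ g t)
                        ; (g@(α∈ , α≢) , inj₂ ¬h) → α∈ , α≢ ∘ trans (agree _ λ { (inj₁ t) → noOut _ g t ; (inj₂ h) → ¬h h }) })
            (good c))
    ... | inj₂ (inj₁ noIn) = Cut.acyclic (_≢ x) (λ v → ¬? (v ≟ x)) (λ g _ → noIn _ g)
          (acyclic-⊆ (λ { (g , inj₂ ¬h) → ⊥-elim (¬h (noIn _ g))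
                        ; (g@(α∈ , α≢) , inj₁ t) → α∈ , α≢ ∘ trans (agree _ λ { (inj₁ t′) → t t′ ; (inj₂ h) → noIn _ g h }) })
            (good c))

  paint : ∀ {k} {Q : Fin m → Set} → Decidable Q → Fin k → (Fin m → Fin k) → Fin m → Fin k
  paint Q? κ col α with Q? α
  ... | yes _ = κ
  ... | no  _ = col α

  module _ {k : ℕ} {Q : Fin m → Set} (Q? : Decidable Q) (κ : Fin k) (col : Fin m → Fin k) {α : Fin m} where

    paint-yes : Q α → paint Q? κ col α ≡ κ
    paint-yes q with Q? α
    ... | yes _ = refl
    ... | no ¬q = ⊥-elim (¬q q)

    paint-no : ¬ Q α → paint Q? κ col α ≡ col α
    paint-no ¬q with Q? α
    ... | yes q = ⊥-elim (¬q q)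
    ... | no  _ = refl

  NoOut NoIn : List (Fin m) → Fin n → Set
  NoOut P x = ∀ {α} → α ∈ P → tl α ≢ x
  NoIn  P x = ∀ {α} → α ∈ P → hd α ≢ x

  -- The arcs `i` and `o` need not lie in `P`; they only bound the arcs of `P` at `x`. Hence a
  -- thread can be formed with arcs of a larger list.
  record Thread (P : List (Fin m)) (x : Fin n) : Set where
    field
      i o  : Fin m
      hd-i : hd i ≡ x
      tl-o : tl o ≡ x
      i!   : ∀ {α} → α ∈ P → hd α ≡ x → α ≡ i
      o!   : ∀ {α} → α ∈ P → tl α ≡ x → α ≡ o

  module _ {k : ℕ} {P : List (Fin m)} {x : Fin n} {col : Fin m → Fin k} (good : Good P col) where

    -- An arc into a sink lies on no closed walk, so its colour is arbitrary.
    recolour-in : NoOut P x → ∀ κ → Good P (paint (λ α → hd α ≟ x) κ col)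
    recolour-in dead κ = recolour-at x good (λ α ¬inc → paint-no (λ α → hd α ≟ x) κ col (¬inc ∘ inj₂))
      (λ c → inj₁ λ α g → dead (proj₁ g))

    recolour-out : NoIn P x → ∀ κ → Good P (paint (λ α → tl α ≟ x) κ col)
    recolour-out dead κ = recolour-at x good (λ α ¬inc → paint-no (λ α → tl α ≟ x) κ col (¬inc ∘ inj₁))
      (λ c → inj₂ (inj₁ λ α g → dead (proj₁ g)))

  repaint : ∀ {k P x} → Thread P x → Fin k → Fin k → (Fin m → Fin k) → Fin m → Fin k
  repaint T κi κo col = paint (_≟ Thread.i T) κi (paint (_≟ Thread.o T) κo col)

  module Repaint (noLoop : ∀ α → tl α ≢ hd α) {k : ℕ} {P : List (Fin m)} {x : Fin n} (T : Thread P x)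
                 (κi κo : Fin k) (col : Fin m → Fin k) where
    open Thread T

    private
      colₒ : Fin m → Fin k
      colₒ = paint (_≟ o) κo col

    i≢o : i ≢ o
    i≢o eq = noLoop i (trans (cong tl eq) (trans tl-o (sym hd-i)))

    at-i : repaint T κi κo col i ≡ κi
    at-i = paint-yes (_≟ i) κi colₒ refl

    at-o : repaint T κi κo col o ≡ κo
    at-o = trans (paint-no (_≟ i) κi colₒ (i≢o ∘ sym)) (paint-yes (_≟ o) κo col refl)

    elsewhere : ∀ {α} → α ≢ i → α ≢ o → repaint T κi κo col α ≡ col α
    elsewhere ≢i ≢o = trans (paint-no (_≟ i) κi colₒ ≢i) (paint-no (_≟ o) κo col ≢o)

    -- Every closed walk through x uses both arcs of the thread, so only the set of their colours matters.
    good : Good P col → col i ≡ κi ⊎ col i ≡ κo → col o ≡ κi ⊎ col o ≡ κo → Good P (repaint T κi κo col)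
    good g ci co = recolour-at x g (λ α ¬inc → elsewhere (λ { refl → ¬inc (inj₂ hd-i) }) (λ { refl → ¬inc (inj₁ tl-o) })) how
      where
      new-col : Fin m → Fin k
      new-col = repaint T κi κo col
      how : ∀ c → (∀ α → Avoiding P new-col c α → tl α ≢ x)
                ⊎ (∀ α → Avoiding P new-col c α → hd α ≢ x)
                ⊎ (∀ α → Avoiding P new-col c α → Avoiding P col c α)
      -- If `c` is a new colour of `i` or of `o`, then no walk avoiding `c` can pass through `x`.
      -- Otherwise `c` is not an old colour either, because the old colours lie among the new ones.
      -- The argument also covers replacing a repeated colour by two different ones.
      how c with c ≟ κi | c ≟ κo
      ... | yes refl | _ = inj₂ (inj₁ λ α (α∈ , α≢) h → α≢ (trans (cong new-col (i! α∈ h)) at-i))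
      ... | no _ | yes refl = inj₁ λ α (α∈ , α≢) t → α≢ (trans (cong new-col (o! α∈ t)) at-o)
      ... | no c≢i | no c≢o = inj₂ (inj₂ incl)
        where
        new : ∀ {d} → d ≡ κi ⊎ d ≡ κo → d ≢ c
        new (inj₁ e) e′ = c≢i (trans (sym e′) e)
        new (inj₂ e) e′ = c≢o (trans (sym e′) e)
        incl : ∀ α → Avoiding P new-col c α → Avoiding P col c α
        incl α (α∈ , α≢) = α∈ , old (α ≟ i) (α ≟ o)
          where
          old : Dec (α ≡ i) → Dec (α ≡ o) → col α ≢ c
          old (yes refl) _          = new ci
          old (no _)     (yes refl) = new co
          old (no ≢i)    (no ≢o)    = α≢ ∘ trans (elsewhere ≢i ≢o)

-- Reduction to a root arc

module _ {n m : ℕ} (tl hd : Fin m → Fin n) (P : List (Fin m)) where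

  open import Data.List.Membership.DecPropositional (_≟_ {m}) using (_∈?_)

  record TwoIn (v : Fin n) : Set where
    constructor twoIn
    field
      α β    : Fin m
      α∈ : α ∈ P
      β∈ : β ∈ P
      hd-α   : hd α ≡ v
      hd-β   : hd β ≡ v
      α≢β    : α ≢ β

  twoIn? : Decidable TwoIn
  twoIn? v with any? (λ α → any? (λ β → α ∈? P ×-dec β ∈? P ×-dec hd α ≟ v ×-dec hd β ≟ v ×-dec ¬? (α ≟ β)))
  ... | yes (α , β , a , b , p , q , r) = yes (twoIn α β a b p q r)
  ... | no none = no λ (twoIn α β a b p q r) → none (α , β , a , b , p , q , r)

  -- Sending v to the tail of its first in-arc would be an injective but not surjective endomap.
  no-twoIn-closed :
    (∀ {α β} → α ∈ P → β ∈ P → tl α ≡ tl β → TwoIn (tl α) → α ≡ β) →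
    (∀ {α} → α ∈ P → TwoIn (hd α) → TwoIn (tl α)) →
    ∀ v → ¬ TwoIn v
  no-twoIn-closed out! closed v₀ two₀ =
    α≢β (trans (is-first α∈ hd-α) (sym (is-first β∈ hd-β)))
    where
    open TwoIn two₀
    pred : (v : Fin n) → Dec (TwoIn v) → Fin n
    pred v (yes t) = tl (TwoIn.α t)
    pred v (no _)  = v

    tail-twoIn : ∀ {v α} → α ∈ P → hd α ≡ v → TwoIn v → TwoIn (tl α)
    tail-twoIn α∈ refl t = closed α∈ t

    injective : ∀ {u v} (du : Dec (TwoIn u)) (dv : Dec (TwoIn v)) → pred u du ≡ pred v dv → u ≡ v
    injective (yes t) (yes s) eq =
      let open TwoIn in
      trans (sym (hd-α t)) (trans (cong hd (out! (α∈ t) (α∈ s) eq (tail-twoIn (α∈ t) (hd-α t) t))) (hd-α s))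
    injective (yes t) (no ¬s) eq = ⊥-elim (¬s (subst TwoIn eq (tail-twoIn (TwoIn.α∈ t) (TwoIn.hd-α t) t)))
    injective (no ¬t) (yes s) eq = ⊥-elim (¬t (subst TwoIn (sym eq) (tail-twoIn (TwoIn.α∈ s) (TwoIn.hd-α s) s)))
    injective (no _)  (no _)  eq = eq

    pred-injective : Injective _≡_ _≡_ (λ v → pred v (twoIn? v))
    pred-injective {u} {v} = injective (twoIn? u) (twoIn? v)

    first : ∀ {v} → Dec (TwoIn v) → Fin m
    first (yes t) = TwoIn.α t
    first (no _)  = α

    only : ∀ {u γ} (d : Dec (TwoIn u)) → γ ∈ P → TwoIn (tl γ) → pred u d ≡ tl γ → γ ≡ first d × u ≡ hd γ
    only (no ¬t) _  two eq = ⊥-elim (¬t (subst TwoIn (sym eq) two))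
    only (yes t) γ∈ two eq with out! γ∈ (TwoIn.α∈ t) (sym eq) two
    ... | refl = refl , sym (TwoIn.hd-α t)

    is-first : ∀ {γ} → γ ∈ P → hd γ ≡ v₀ → γ ≡ first (twoIn? v₀)
    -- The tail of `γ` is a value of `pred` by surjectivity. As this tail has two in-arcs, it is not
    -- the value at a fixed vertex without two in-arcs, so it is the tail of the first in-arc of
    -- some `u`. By `out!` that arc is `γ`, and `u` is `v₀`.
    is-first {γ} γ∈ refl with injective⇒surjective pred-injective (tl γ)
    ... | u , eq with only (twoIn? u) γ∈ (closed γ∈ two₀) eq
    ...   | γ≡ , refl = γ≡

-- The degree bound appears as the impossibility of four arcs at one vertex, once for each split
-- with both directions present. In this form it applies directly in case distinctions.
record Subcubic {n m : ℕ} (tl hd : Fin m → Fin n) : Set where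
  field
    noLoop  : ∀ α → tl α ≢ hd α
    no2cyc  : ∀ α β → tl α ≡ hd β → hd α ≡ tl β → ⊥
    in₃out₁ : ∀ {v α β γ δ} → hd α ≡ v → hd β ≡ v → hd γ ≡ v → tl δ ≡ v →
              α ≢ β → α ≢ γ → β ≢ γ → ⊥
    in₂out₂ : ∀ {v α β γ δ} → hd α ≡ v → hd β ≡ v → tl γ ≡ v → tl δ ≡ v → α ≢ β → γ ≢ δ → ⊥
    in₁out₃ : ∀ {v α β γ δ} → hd α ≡ v → tl β ≡ v → tl γ ≡ v → tl δ ≡ v →
              β ≢ γ → β ≢ δ → γ ≢ δ → ⊥

module Colouring {n m : ℕ} (tl hd : Fin m → Fin n) (sub : Subcubic tl hd) where

  open Subcubic sub
  open Walks tl hd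
  open import Data.List.Membership.DecPropositional (_≟_ {m}) using (_∈?_)

  NoSink NoSource : List (Fin m) → Set
  NoSink   P = ∀ {α} → α ∈ P → ∃ λ β → β ∈ P × tl β ≡ hd α
  NoSource P = ∀ {α} → α ∈ P → ∃ λ β → β ∈ P × hd β ≡ tl α

  record Root (P : List (Fin m)) : Set where
    field
      r    : Fin m
      r∈   : r ∈ P
      out! : ∀ {α} → α ∈ P → tl α ≡ tl r → α ≡ r
      in!  : ∀ {α} → α ∈ P → hd α ≡ hd r → α ≡ r
    a b : Fin n
    a = hd r
    b = tl r

  Apart : ∀ {P} → Root P → Fin m → Set
  Apart R α = (tl α ≢ b × tl α ≢ a) × (hd α ≢ b × hd α ≢ a)
    where open Root R

  apart? : ∀ {P} (R : Root P) → Decidable (Apart R)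
  apart? R α = (¬? (tl α ≟ b) ×-dec ¬? (tl α ≟ a)) ×-dec (¬? (hd α ≟ b) ×-dec ¬? (hd α ≟ a))
    where open Root R

  core : ∀ {P} → Root P → List (Fin m)
  core {P} R = filter (apart? R) P

  module Induction {k : ℕ}
    (step : ∀ {P} → NoSink P → NoSource P → (R : Root P) →
            {col : Fin m → Fin (suc k)} → Good (core R) col → ∃ λ (col : Fin m → Fin (suc k)) → Good P col) where

    Colourable : List (Fin m) → Set
    Colourable P = ∃ λ (col : Fin m → Fin (suc k)) → Good P col

    delete : Fin m → List (Fin m) → List (Fin m)
    delete α = filter (λ β → ¬? (β ≟ α))

    delete-shorter : ∀ {α P} → α ∈ P → length (delete α P) < length P
    delete-shorter {α} {P} α∈ = filter-notAll (λ β → ¬? (β ≟ α)) P (lose α∈ λ ne → ne refl)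

    delete-entering : ∀ {P α} (U : Fin n → Set) → Decidable U → (∀ {β} → β ∈ P → U (tl β) → U (hd β)) →
      ¬ U (tl α) → U (hd α) → Colourable (delete α P) → Colourable P
    delete-entering {P} {α} U U? closed ¬Ut Uh (col , good) = col , remove-entering U U? closed
      (λ { β∈ ne → ∈-filter⁺ (λ β → ¬? (β ≟ α)) β∈ λ { refl → not-both ne } }) good
      where
      not-both : ¬ (U (tl α) ⊎ ¬ U (hd α))
      not-both (inj₁ Ut)  = ¬Ut Ut
      not-both (inj₂ ¬Uh) = ¬Uh Uh

    NonRoot : List (Fin m) → Set
    NonRoot P = ∀ {r} → r ∈ P → ∃ λ α → α ∈ P × α ≢ r × (tl α ≡ tl r ⊎ hd α ≡ hd r)

    -- Without roots, having in-degree two propagates along arcs.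
    module Rootless {P : List (Fin m)} (noSink : NoSink P) (nonRoot : NonRoot P) where

      In₂ Out₂ : Fin n → Set
      In₂  = TwoIn tl hd P
      Out₂ = TwoIn hd tl P

      in₂-out! : ∀ {α β} → α ∈ P → β ∈ P → tl α ≡ tl β → In₂ (tl α) → α ≡ β
      in₂-out! {α} {β} _ _ eq (twoIn _ _ _ _ h h′ ne) with α ≟ β
      ... | yes e  = e
      ... | no α≢β = ⊥-elim (in₂out₂ h h′ refl (sym eq) ne α≢β)

      out₂-in! : ∀ {α β} → α ∈ P → β ∈ P → hd α ≡ hd β → Out₂ (hd α) → α ≡ β
      out₂-in! {α} {β} _ _ eq (twoIn _ _ _ _ t t′ ne) with α ≟ β
      ... | yes e  = e
      ... | no α≢β = ⊥-elim (in₂out₂ refl (sym eq) t t′ α≢β ne)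

      in₂-closed : ∀ {α} → α ∈ P → In₂ (tl α) → In₂ (hd α)
      in₂-closed α∈ two with nonRoot α∈
      ... | β , β∈ , β≢α , inj₁ t = ⊥-elim (β≢α (sym (in₂-out! α∈ β∈ (sym t) two)))
      ... | β , β∈ , β≢α , inj₂ h = twoIn _ β α∈ β∈ refl h (β≢α ∘ sym)

      -- Under `back`, `no-twoIn-closed` excludes vertices with two in-arcs. As no arc is a root,
      -- each arc then shares its tail with another one; without sinks the heads are tails too. So
      -- having two out-arcs propagates everywhere, which the same lemma excludes in the reversed
      -- digraph.
      impossible : (∀ {α} → α ∈ P → In₂ (hd α) → In₂ (tl α)) → ∀ {α} → α ∈ P → ⊥
      impossible back {α} α∈ = no-twoIn-closed hd tl P out₂-in! (λ β∈ _ → out₂-hd β∈) (tl α) (out₂-tl α∈)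
        where
        out₂-tl : ∀ {α} → α ∈ P → Out₂ (tl α)
        out₂-tl α∈ with nonRoot α∈
        ... | β , β∈ , β≢α , inj₁ t = twoIn _ β α∈ β∈ refl t (β≢α ∘ sym)
        ... | β , β∈ , β≢α , inj₂ h = ⊥-elim (no-twoIn-closed tl hd P in₂-out! back _ (twoIn _ β α∈ β∈ refl h (β≢α ∘ sym)))
        out₂-hd : ∀ {α} → α ∈ P → Out₂ (hd α)
        out₂-hd α∈ with noSink α∈
        ... | β , β∈ , t = subst Out₂ t (out₂-tl β∈)

    search : {R : Fin m → Fin m → Set} → (∀ α β → Dec (R α β)) → ∀ P →
      (∃ λ α → α ∈ P × ¬ ∃ (R α)) ⊎ (∀ {α} → α ∈ P → ∃ (R α))
    search {R} R? P with any? (λ α → α ∈? P ×-dec ¬? (any? (R? α)))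
    ... | yes found = inj₁ found
    ... | no none = inj₂ λ {α} α∈ → decide α∈ (any? (R? α))
      where
      decide : ∀ {α} → α ∈ P → Dec (∃ (R α)) → ∃ (R α)
      decide _  (yes w) = w
      decide α∈ (no ¬w) = ⊥-elim (none (_ , α∈ , ¬w))

    root : ∀ {P r} → r ∈ P → ¬ (∃ λ α → α ∈ P × α ≢ r × (tl α ≡ tl r ⊎ hd α ≡ hd r)) → Root P
    root {P} {r} r∈ none = record { r = r ; r∈ = r∈ ; out! = λ α∈ t → same α∈ (inj₁ t) ; in! = λ α∈ h → same α∈ (inj₂ h) }
      where
      same : ∀ {α} → α ∈ P → tl α ≡ tl r ⊎ hd α ≡ hd r → α ≡ r
      same {α} α∈ meets with α ≟ r
      ... | yes e  = e
      ... | no α≢r = ⊥-elim (none (α , α∈ , α≢r , meets))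

    -- Induction on the number of arcs. An arc into a sink, out of a source, or into the closed set
    -- of vertices with two in-arcs lies on no closed walk and is deleted. If a root exists, both of
    -- its ends are deleted and `step` restores them.
    colour : ∀ P → Acc _<_ (length P) → Colourable P
    colour P (acc rec) with search (λ α β → β ∈? P ×-dec tl β ≟ hd α) P
    ... | inj₁ (α , α∈ , sink) = delete-entering (_≡ hd α) (_≟ hd α)
          (λ β∈ t → ⊥-elim (sink (_ , β∈ , t))) (noLoop α) refl
          (colour (delete α P) (rec (delete-shorter α∈)))
    ... | inj₂ noSink with search (λ α β → β ∈? P ×-dec hd β ≟ tl α) P
    ...   | inj₁ (α , α∈ , source) = delete-entering (_≢ tl α) (λ v → ¬? (v ≟ tl α))
            (λ β∈ _ h → source (_ , β∈ , h)) (λ ne → ne refl) (noLoop α ∘ sym)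
            (colour (delete α P) (rec (delete-shorter α∈)))
    ...   | inj₂ noSource with search (λ r α → α ∈? P ×-dec ¬? (α ≟ r) ×-dec (tl α ≟ tl r ⊎-dec hd α ≟ hd r)) P
    ...     | inj₁ (r , r∈ , none) = step noSink noSource R (proj₂ (colour (core R) (rec shorter)))
      where
      R = root r∈ none
      shorter : length (core R) < length P
      shorter = filter-notAll (apart? R) P (lose r∈ λ ((≢b , _) , _) → ≢b refl)
    ...     | inj₂ nonRoot with any? (λ α → α ∈? P ×-dec twoIn? tl hd P (hd α) ×-dec ¬? (twoIn? tl hd P (tl α)))
    ...       | yes (α , α∈ , two , ¬two) = delete-entering (TwoIn tl hd P) (twoIn? tl hd P)
                (Rootless.in₂-closed noSink nonRoot) ¬two two
                (colour (delete α P) (rec (delete-shorter α∈)))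
    -- Any arc of `P` would now be contradictory, so `P` is empty and a constant colouring serves.
    ...       | no noEntry = (λ _ → zero) , λ c α (α∈ , _) _ → Rootless.impossible noSink nonRoot back α∈
      where
      back : ∀ {α} → α ∈ P → TwoIn tl hd P (hd α) → TwoIn tl hd P (tl α)
      back {α} α∈ two with twoIn? tl hd P (tl α)
      ... | yes t = t
      ... | no ¬t = ⊥-elim (noEntry (α , α∈ , two , ¬t))

  -- Insertion of a root arc

  module Step {P : List (Fin m)} (noSink : NoSink P) (noSource : NoSource P) (R : Root P) where

    open Root R

    Q : List (Fin m)
    Q = core R

    Q⊆P : ∀ {α} → α ∈ Q → α ∈ P
    Q⊆P = proj₁ ∘ ∈-filter⁻ (apart? R)

    Q-apart : ∀ {α} → α ∈ Q → Apart R α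
    Q-apart = proj₂ ∘ ∈-filter⁻ (apart? R) {xs = P}

    Enters Leaves : Fin m → Set
    Enters α = α ∈ P × hd α ≡ b
    Leaves β = β ∈ P × tl β ≡ a

    a≢b : a ≢ b
    a≢b = noLoop r ∘ sym

    enters≢b : ∀ {α} → Enters α → tl α ≢ b
    enters≢b (_ , h) t = noLoop _ (trans t (sym h))

    enters≢a : ∀ {α} → Enters α → tl α ≢ a
    enters≢a (_ , h) t = no2cyc _ r t h

    leaves≢b : ∀ {β} → Leaves β → hd β ≢ b
    leaves≢b (_ , t) h = no2cyc _ r t h

    leaves≢a : ∀ {β} → Leaves β → hd β ≢ a
    leaves≢a (_ , t) h = noLoop _ (trans t (sym h))

    -- Extending a colouring across the root arc

    module _ {G : Fin m → Set} where

      uncons : ∀ {u w} → Walk G u w → u ≢ w → ∃ λ α → G α × tl α ≡ u × Walk G (hd α) w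
      uncons nil            u≢w = ⊥-elim (u≢w refl)
      uncons (cons α g t w) _   = α , g , t , w

      unsnoc : ∀ {u w} → Walk G u w → u ≢ w → ∃ λ α → G α × hd α ≡ w × Walk G u (tl α)
      unsnoc nil                       u≢w = ⊥-elim (u≢w refl)
      unsnoc {w = w} (cons α g refl W) _ with hd α ≟ w
      ... | yes h = α , g , h , nil
      ... | no ≢w = let β , g′ , h , W′ = unsnoc W ≢w in β , g′ , h , cons α g refl W′

    -- A closed walk through the root contains some `α`, `r`, `β` in succession and returns from the
    -- head of `β` to the tail of `α`. The return must meet every colour missing from these three
    -- arcs.
    CutPair : ∀ {k} (col ε φ : Fin m → Fin k) (ρ : Fin k) → Set
    CutPair col ε φ ρ = ∀ {α β c} → Enters α → Leaves β → c ≢ ε α → c ≢ ρ → c ≢ φ β →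
      Walk (Avoiding Q col c) (hd β) (tl α) → ⊥

    module _ {k : ℕ} {col : Fin m → Fin k} (good : Good Q col) (ε φ : Fin m → Fin k) (ρ : Fin k)
             (cut : CutPair col ε φ ρ) where

      opaque

        extended : Fin m → Fin k
        extended α with hd α ≟ b | hd α ≟ a | tl α ≟ a
        ... | yes _ | _     | _     = ε α
        ... | no _  | yes _ | _     = ρ
        ... | no _  | no _  | yes _ = φ α
        ... | no _  | no _  | no _  = col α

        extended-enters : ∀ {α} → Enters α → extended α ≡ ε α
        extended-enters {α} (_ , h) with hd α ≟ b
        ... | yes _ = refl
        ... | no ¬h = ⊥-elim (¬h h)

        extended-root : extended r ≡ ρ
        extended-root with hd r ≟ b | hd r ≟ a
        ... | yes h | _     = ⊥-elim (a≢b h)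
        ... | no _  | yes _ = refl
        ... | no _  | no ¬h = ⊥-elim (¬h refl)

        extended-leaves : ∀ {β} → Leaves β → extended β ≡ φ β
        extended-leaves {β} leaves with hd β ≟ b | hd β ≟ a | tl β ≟ a
        ... | yes h | _     | _     = ⊥-elim (leaves≢b leaves h)
        ... | no _  | yes h | _     = ⊥-elim (leaves≢a leaves h)
        ... | no _  | no _  | yes _ = refl
        ... | no _  | no _  | no ¬t = ⊥-elim (¬t (proj₂ leaves))

        extended-apart : ∀ {α} → Apart R α → extended α ≡ col α
        extended-apart {α} ((_ , t≢a) , (h≢b , h≢a)) with hd α ≟ b | hd α ≟ a | tl α ≟ a
        ... | yes h | _     | _     = ⊥-elim (h≢b h)
        ... | no _  | yes h | _     = ⊥-elim (h≢a h)
        ... | no _  | no _  | yes t = ⊥-elim (t≢a t)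
        ... | no _  | no _  | no _  = refl

      module _ (c : Fin k) where

        G H : Fin m → Set
        G = Avoiding P extended c
        H = Avoiding Q col c

        G⇒H : ∀ {α} → G α → Apart R α → H α
        G⇒H (α∈ , α≢c) ap = ∈-filter⁺ (apart? R) α∈ ap , α≢c ∘ trans (extended-apart ap)

        -- The walk is cut at its first arrival at `b`. It cannot visit `a` earlier, since the only
        -- arc into `a` starts at `b`.
        toB : ∀ {u w} → Walk G u w → w ≡ b → u ≢ b → u ≢ a → ∃ λ α → G α × hd α ≡ b × Walk H u (tl α)
        toB nil w≡b u≢b _ = ⊥-elim (u≢b w≡b)
        toB (cons α g refl w) w≡b u≢b u≢a with hd α ≟ b | hd α ≟ a
        ... | yes h | _     = α , g , h , nil
        ... | no _  | yes h = ⊥-elim (u≢b (cong tl (in! (proj₁ g) h)))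
        ... | no h≢b | no h≢a =
          let γ , gγ , hγ , w′ = toB w w≡b h≢b h≢a
          in γ , gγ , hγ , cons α (G⇒H g ((u≢b , u≢a) , h≢b , h≢a)) refl w′

        no-a⇝b : G r → Walk G a b → ⊥
        no-a⇝b (_ , r≢c) w with uncons w a≢b
        ... | β , (β∈ , β≢c) , t , w′ with toB w′ refl (leaves≢b (β∈ , t)) (leaves≢a (β∈ , t))
        ...   | α , (α∈ , α≢c) , h , w″ =
          cut (α∈ , h) (β∈ , t)
            (λ e → α≢c (trans (extended-enters (α∈ , h)) (sym e)))
            (λ e → r≢c (trans extended-root (sym e)))
            (λ e → β≢c (trans (extended-leaves (β∈ , t)) (sym e))) w″

        Closed : Fin n → Set
        Closed z = ∃ λ β → G β × tl β ≡ z × Walk G (hd β) z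

        -- A closed walk through `b` leaves it by `r`, and one through `a` arrives by `r`. In both
        -- cases taking out `r` leaves a walk from `a` to `b`.
        not-closed : ∀ {z} → z ≡ b ⊎ z ≡ a → ¬ Closed z
        not-closed (inj₁ refl) (β , g , t , w) with out! (proj₁ g) t
        ... | refl = no-a⇝b g w
        not-closed (inj₂ refl) (β , g , t , w) with unsnoc w (leaves≢a (proj₁ g , t))
        ... | α , g′ , h , w′ with in! (proj₁ g′) h
        ...   | refl = no-a⇝b g′ (cons β g t w′)

        Passes : Fin n → Fin n → Set
        Passes u w = ∃ λ z → (z ≡ b ⊎ z ≡ a) × Walk G u z × ∃ λ β → G β × tl β ≡ z × Walk G (hd β) w

        start≢ : ∀ {u w z} → (∀ {α} → H α → tl α ≢ z) → Walk H u w → w ≢ z → u ≢ z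
        start≢ apart nil            w≢z = w≢z
        start≢ apart (cons α h refl _) _ = apart h

        toH : ∀ {u w} → w ≢ b → w ≢ a → Walk G u w → Walk H u w ⊎ Passes u w
        toH w≢b w≢a nil = inj₁ nil
        toH w≢b w≢a (cons α g refl w) with tl α ≟ b | tl α ≟ a
        ... | yes t | _     = inj₂ (_ , inj₁ t , nil , α , g , refl , w)
        ... | no _  | yes t = inj₂ (_ , inj₂ t , nil , α , g , refl , w)
        ... | no t≢b | no t≢a with toH w≢b w≢a w
        ...   | inj₂ (z , z≡ , w₁ , rest) = inj₂ (z , z≡ , cons α g refl w₁ , rest)
        ...   | inj₁ w′ = inj₁ (cons α (G⇒H g ((t≢b , t≢a) , start≢ (proj₁ ∘ proj₁ ∘ Q-apart ∘ proj₁) w′ w≢b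
                                                            , start≢ (proj₂ ∘ proj₁ ∘ Q-apart ∘ proj₁) w′ w≢a)) refl w′)

        acyclic : Acyclic G
        acyclic α g w with tl α ≟ b | tl α ≟ a
        ... | yes t | _     = not-closed (inj₁ t) (α , g , refl , w)
        ... | no _  | yes t = not-closed (inj₂ t) (α , g , refl , w)
        ... | no t≢b | no t≢a with toH t≢b t≢a w
        ...   | inj₁ w′ = good c α (G⇒H g ((t≢b , t≢a) , start≢ (proj₁ ∘ proj₁ ∘ Q-apart ∘ proj₁) w′ t≢b
                                                      , start≢ (proj₂ ∘ proj₁ ∘ Q-apart ∘ proj₁) w′ t≢a)) w′
        -- The closed walk is rotated so that it starts at its visit to `z`.
        ...   | inj₂ (z , z≡ , w₁ , β , gβ , t , w₂) = not-closed z≡ (β , gβ , t , w₂ ++ʷ cons α g refl w₁)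

      extended-good : ∃ λ (col : Fin m → Fin k) → Good P col
      extended-good = extended , acyclic

    -- Arcs near the ends of the root

    in-side : ∀ {α} → Enters α → NoOut Q (tl α) ⊎ Thread Q (tl α)
    in-side {α} en@(α∈ , h) with any? (λ γ → γ ∈? Q ×-dec tl γ ≟ tl α)
    ... | no none = inj₁ λ γ∈ t → none (_ , γ∈ , t)
    ... | yes (o , o∈ , tl-o) with noSource α∈
    ...   | i , i∈ , hd-i = inj₂ record
      { i = i ; o = o ; hd-i = hd-i ; tl-o = tl-o
      -- The deleted arc `α` takes one of the three places at its tail. Next to `i` and `o`, any
      -- further arc of `Q` there would raise the degree to four.
      ; i! = λ {γ} γ∈ hγ → decidable-stable (γ ≟ i) λ γ≢i → in₂out₂ hγ hd-i tl-o refl γ≢i (≢α o∈)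
      ; o! = λ {γ} γ∈ tγ → decidable-stable (γ ≟ o) λ γ≢o → in₁out₃ hd-i tγ tl-o refl γ≢o (≢α γ∈) (≢α o∈)
      }
      where
      ≢α : ∀ {γ} → γ ∈ Q → γ ≢ α
      ≢α γ∈ refl = proj₁ (proj₂ (Q-apart γ∈)) h

    out-side : ∀ {β} → Leaves β → NoIn Q (hd β) ⊎ Thread Q (hd β)
    out-side {β} (β∈ , t) with any? (λ γ → γ ∈? Q ×-dec hd γ ≟ hd β)
    ... | no none = inj₁ λ γ∈ h → none (_ , γ∈ , h)
    ... | yes (i , i∈ , hd-i) with noSink β∈
    ...   | o , o∈ , tl-o = inj₂ record
      { i = i ; o = o ; hd-i = hd-i ; tl-o = tl-o
      ; i! = λ {γ} γ∈ hγ → decidable-stable (γ ≟ i) λ γ≢i → in₃out₁ hγ hd-i refl tl-o γ≢i (≢β γ∈) (≢β i∈)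
      ; o! = λ {γ} γ∈ tγ → decidable-stable (γ ≟ o) λ γ≢o → in₂out₂ hd-i refl tγ tl-o (≢β i∈) γ≢o
      }
      where
      ≢β : ∀ {γ} → γ ∈ Q → γ ≢ β
      ≢β γ∈ refl = proj₂ (proj₁ (Q-apart γ∈)) t

    -- The root takes one of the three places at `b`. If only one arc enters `b`, then `e₁` and `e₂`
    -- coincide.
    in-arcs : ∃ λ e₁ → ∃ λ e₂ → Enters e₁ × Enters e₂ × (∀ {α} → Enters α → α ≡ e₁ ⊎ α ≡ e₂)
    in-arcs with noSource r∈
    ... | e₁ , e₁∈ , h₁ with any? (λ α → (α ∈? P ×-dec hd α ≟ b) ×-dec ¬? (α ≟ e₁))
    ...   | no none = e₁ , e₁ , (e₁∈ , h₁) , (e₁∈ , h₁) , λ {α} en →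
      inj₁ (decidable-stable (α ≟ e₁) λ α≢ → none (α , en , α≢))
    ...   | yes (e₂ , en₂ , e₂≢e₁) = e₁ , e₂ , (e₁∈ , h₁) , en₂ , λ {α} (α∈ , h) →
      decidable-stable ((α ≟ e₁) ⊎-dec (α ≟ e₂)) λ neither →
        in₃out₁ h h₁ (proj₂ en₂) refl (neither ∘ inj₁) (neither ∘ inj₂) (e₂≢e₁ ∘ sym)

    out-arcs : ∃ λ f₁ → ∃ λ f₂ → Leaves f₁ × Leaves f₂ × (∀ {β} → Leaves β → β ≡ f₁ ⊎ β ≡ f₂)
    out-arcs with noSink r∈
    ... | f₁ , f₁∈ , t₁ with any? (λ β → (β ∈? P ×-dec tl β ≟ a) ×-dec ¬? (β ≟ f₁))
    ...   | no none = f₁ , f₁ , (f₁∈ , t₁) , (f₁∈ , t₁) , λ {β} le →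
      inj₁ (decidable-stable (β ≟ f₁) λ β≢ → none (β , le , β≢))
    ...   | yes (f₂ , le₂ , f₂≢f₁) = f₁ , f₂ , (f₁∈ , t₁) , le₂ , λ {β} (β∈ , t) →
      decidable-stable ((β ≟ f₁) ⊎-dec (β ≟ f₂)) λ neither →
        in₁out₃ refl t t₁ (proj₂ le₂) (neither ∘ inj₁) (neither ∘ inj₂) (f₂≢f₁ ∘ sym)

    module _ {k : ℕ} (col : Fin m → Fin k) where

      -- κ colours the in-arcs of the tail of α, except those coming from the tail of another entering arc
      -- whose in-arcs have colour κ.
      CoversIn : Fin m → Fin k → Set
      CoversIn α κ = ∀ {γ} → γ ∈ Q → hd γ ≡ tl α →
        col γ ≡ κ ⊎ ∃ λ α′ → Enters α′ × tl γ ≡ tl α′ × (∀ {δ} → δ ∈ Q → hd δ ≡ tl α′ → col δ ≡ κ)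

      CoversOut : Fin m → Fin k → Set
      CoversOut β κ = ∀ {γ} → γ ∈ Q → tl γ ≡ hd β →
        col γ ≡ κ ⊎ ∃ λ β′ → Leaves β′ × hd γ ≡ hd β′ × (∀ {δ} → δ ∈ Q → tl δ ≡ hd β′ → col δ ≡ κ)

      module _ (noTriangle : ∀ {α β} → Enters α → Leaves β → hd β ≢ tl α) where

        -- The last arc of the walk has colour `κ`, or it comes from the tail of another entering
        -- arc. By `noTriangle` the walk does not start at that tail, so the arc before it exists
        -- and has colour `κ`.
        covered-in : ∀ {α β κ} → Enters α → Leaves β → CoversIn α κ → ¬ Walk (Avoiding Q col κ) (hd β) (tl α)
        covered-in en le cov w with unsnoc w (noTriangle en le)
        ... | γ , (γ∈ , ≢κ) , h , w′ with cov γ∈ h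
        ...   | inj₁ ≡κ = ≢κ ≡κ
        ...   | inj₂ (α′ , en′ , t , cov′) with unsnoc w′ (noTriangle en′ le ∘ λ eq → trans eq t)
        ...     | δ , (δ∈ , δ≢κ) , h′ , _ = δ≢κ (cov′ δ∈ (trans h′ t))

        covered-out : ∀ {α β κ} → Enters α → Leaves β → CoversOut β κ → ¬ Walk (Avoiding Q col κ) (hd β) (tl α)
        covered-out en le cov w with uncons w (noTriangle en le)
        ... | γ , (γ∈ , ≢κ) , t , w′ with cov γ∈ t
        ...   | inj₁ ≡κ = ≢κ ≡κ
        ...   | inj₂ (β′ , le′ , h , cov′) with uncons w′ (noTriangle en le′ ∘ trans (sym h))
        ...     | δ , (δ∈ , δ≢κ) , t′ , _ = δ≢κ (cov′ δ∈ (trans t′ h))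

    -- Choosing the colours before the entering arcs

    module InPhase {k : ℕ} (3≤k : 3 ≤ k) (κ₁ κ₂ : Fin k) where

      Allowed : Fin k → Set
      Allowed κ = κ ≢ κ₁ × κ ≢ κ₂

      some-allowed : ∃ Allowed
      some-allowed with fresh (κ₁ ∷ κ₂ ∷ []) 3≤k
      ... | κ , κ∉ = κ , (λ { refl → κ∉ (here refl) }) , λ { refl → κ∉ (there (here refl)) }

      -- A thread is blocked exactly if its two arcs carry two different colours, both of them
      -- forbidden.
      Unblocked : (Fin m → Fin k) → ∀ {x} → NoOut Q x ⊎ Thread Q x → Set
      Unblocked col (inj₁ _) = ⊤
      Unblocked col (inj₂ T) = col i ≡ col o ⊎ Allowed (col i) ⊎ Allowed (col o)
        where open Thread T

      record Reached (col : Fin m → Fin k) (x : Fin n) (T : Thread Q x) : Set where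
        open Thread T
        field
          new     : Fin m → Fin k
          good    : Good Q new
          allowed : Allowed (new i)
          kept    : ∀ {γ} → γ ≢ i → γ ≢ o → new γ ≡ col γ

      reach : ∀ {col x} → Good Q col → (T : Thread Q x) → Unblocked col (inj₂ T) → Reached col x T
      reach {col} good T (inj₁ eq) = record
        -- As `i` and `o` have the same colour, `o` alone keeps it on every closed walk through `x`,
        -- and `i` is free to take an allowed colour.
        { new = repaint T κ (col o) col ; good = R.good good (inj₂ eq) (inj₂ refl)
        ; allowed = subst Allowed (sym R.at-i) (proj₂ some-allowed) ; kept = R.elsewhere }
        where
        open Thread T
        κ = proj₁ some-allowed
        module R = Repaint noLoop T κ (col o) col
      reach {col} good T (inj₂ (inj₁ ok)) = record { new = col ; good = good ; allowed = ok ; kept = λ _ _ → refl }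
      reach {col} good T (inj₂ (inj₂ ok)) = record
        { new = repaint T (col o) (col i) col ; good = R.good good (inj₂ refl) (inj₁ refl)
        ; allowed = subst Allowed (sym R.at-i) ok ; kept = R.elsewhere }
        where
        open Thread T
        module R = Repaint noLoop T (col o) (col i) col

      record Single (col : Fin m → Fin k) (x : Fin n) : Set where
        field
          new     : Fin m → Fin k
          good    : Good Q new
          κ       : Fin k
          allowed : Allowed κ
          covers  : ∀ {γ} → γ ∈ Q → hd γ ≡ x → new γ ≡ κ
          kept    : ∀ {γ} → ¬ Incident x γ → new γ ≡ col γ

      thread-single : ∀ {col x} {T : Thread Q x} → Reached col x T → Single col x
      thread-single {T = T} record { new = new ; good = good ; allowed = allowed ; kept = kept } = record
        { new = new ; good = good ; κ = new i ; allowed = allowed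
        ; covers = λ γ∈ h → cong new (i! γ∈ h)
        ; kept = λ ¬inc → kept (λ { refl → ¬inc (inj₂ hd-i) }) (λ { refl → ¬inc (inj₁ tl-o) }) }
        where open Thread T

      free-single : ∀ {col x} → Good Q col → NoOut Q x → Single col x
      free-single {col} {x} good dead = record
        { new = paint (λ γ → hd γ ≟ x) κ col ; good = recolour-in good dead κ ; κ = κ ; allowed = proj₂ some-allowed
        ; covers = λ _ h → paint-yes (λ γ → hd γ ≟ x) κ col h
        ; kept = λ ¬inc → paint-no (λ γ → hd γ ≟ x) κ col (¬inc ∘ inj₂) }
        where κ = proj₁ some-allowed

      single : ∀ {col x} → Good Q col → (s : NoOut Q x ⊎ Thread Q x) → Unblocked col s → Single col x
      single good (inj₁ dead) _  = free-single good dead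
      single good (inj₂ T)    ok = thread-single (reach good T ok)

      -- With five colours, `kept` is what preserves the colours already chosen after the leaving
      -- arcs.
      record Outcome (col : Fin m → Fin k) (e₁ e₂ : Fin m) : Set where
        constructor outcome
        field
          new      : Fin m → Fin k
          good     : Good Q new
          μ₁ μ₂    : Fin k
          allowed₁ : Allowed μ₁
          allowed₂ : Allowed μ₂
          covers₁  : CoversIn new e₁ μ₁
          covers₂  : CoversIn new e₂ μ₂
          kept     : ∀ {γ} → ¬ Incident (tl e₁) γ → ¬ Incident (tl e₂) γ → new γ ≡ col γ

      swap : ∀ {col e₁ e₂} → Outcome col e₁ e₂ → Outcome col e₂ e₁
      swap (outcome new good μ₁ μ₂ a₁ a₂ c₁ c₂ kept) = outcome new good μ₂ μ₁ a₂ a₁ c₂ c₁ λ p q → kept q p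

      -- Repainting the in-arcs of the free vertex last leaves those of the other vertex alone.
      one-free : ∀ {col e₁ e₂} → Good Q col → tl e₁ ≢ tl e₂ → NoOut Q (tl e₁) → (s : NoOut Q (tl e₂) ⊎ Thread Q (tl e₂)) →
        Unblocked col s → Outcome col e₁ e₂
      one-free {col} {e₁} {e₂} good x₁≢x₂ dead s ok = outcome new
        (recolour-in S.good dead κ) κ S.κ (proj₂ some-allowed) S.allowed
        (λ _ h → inj₁ (paint-yes (λ γ → hd γ ≟ tl e₁) κ S.new h))
        (λ γ∈ h → inj₁ (trans (paint-no (λ γ → hd γ ≟ tl e₁) κ S.new (λ h′ → x₁≢x₂ (trans (sym h′) h))) (S.covers γ∈ h)))
        (λ ¬inc₁ ¬inc₂ → trans (paint-no (λ γ → hd γ ≟ tl e₁) κ S.new (¬inc₁ ∘ inj₂)) (S.kept ¬inc₂))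
        where
        κ = proj₁ some-allowed
        module S = Single (single good s ok)
        new : Fin m → Fin k
        new = paint (λ γ → hd γ ≟ tl e₁) κ S.new

      -- When the thread through the first vertex runs into the second, one repainting serves both.
      chained : ∀ {col e₁ e₂} → Good Q col → Enters e₁ → (T₁ : Thread Q (tl e₁)) (T₂ : Thread Q (tl e₂)) →
        Thread.o T₁ ≡ Thread.i T₂ → Unblocked col (inj₂ T₁) → Outcome col e₁ e₂
      chained good en₁ T₁ T₂ o₁≡i₂ ok = outcome S.new S.good S.κ S.κ S.allowed S.allowed
        (λ γ∈ h → inj₁ (S.covers γ∈ h))
        (λ γ∈ h → inj₂ (_ , en₁ , trans (cong tl (trans (Thread.i! T₂ γ∈ h) (sym o₁≡i₂))) (Thread.tl-o T₁) , S.covers))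
        (λ ¬inc₁ _ → S.kept ¬inc₁)
        where module S = Single (single good (inj₂ T₁) ok)

      in-phase : ∀ {col e₁ e₂} → Good Q col → Enters e₁ → Enters e₂ →
        (s₁ : NoOut Q (tl e₁) ⊎ Thread Q (tl e₁)) (s₂ : NoOut Q (tl e₂) ⊎ Thread Q (tl e₂)) →
        Unblocked col s₁ → Unblocked col s₂ → Outcome col e₁ e₂
      in-phase {col} {e₁} {e₂} good en₁ en₂ s₁ s₂ ok₁ ok₂ with tl e₁ ≟ tl e₂
      ... | yes eq = outcome S.new S.good S.κ S.κ S.allowed S.allowed
              (λ γ∈ h → inj₁ (S.covers γ∈ h)) (λ γ∈ h → inj₁ (S.covers γ∈ (trans h (sym eq)))) (λ ¬inc₁ _ → S.kept ¬inc₁)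
        where module S = Single (single good s₁ ok₁)
      in-phase good en₁ en₂ (inj₁ dead) s₂ ok₁ ok₂ | no x₁≢x₂ = one-free good x₁≢x₂ dead s₂ ok₂
      in-phase good en₁ en₂ s₁@(inj₂ _) (inj₁ dead) ok₁ ok₂ | no x₁≢x₂ = swap (one-free good (x₁≢x₂ ∘ sym) dead s₁ ok₁)
      in-phase {col} {e₁} {e₂} good en₁ en₂ (inj₂ T₁) (inj₂ T₂) ok₁ ok₂ | no x₁≢x₂
        with Thread.o T₁ ≟ Thread.i T₂ | Thread.o T₂ ≟ Thread.i T₁
      ... | yes o₁≡i₂ | _ = chained good en₁ T₁ T₂ o₁≡i₂ ok₁
      ... | no _ | yes o₂≡i₁ = swap (chained good en₂ T₂ T₁ o₂≡i₁ ok₂)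
      -- The threads have no arc in common. So the second stays unblocked while the first is
      -- repainted, and repainting the second does not disturb the first.
      ... | no o₁≢i₂ | no o₂≢i₁ = outcome R₂.new R₂.good (R₁.new T₁.i) (R₂.new T₂.i) R₁.allowed R₂.allowed
              (λ γ∈ h → inj₁ (trans (R₂.kept (λ { refl → i₁≢i₂ (sym (T₁.i! γ∈ h)) }) λ { refl → o₂≢i₁ (T₁.i! γ∈ h) })
                                    (cong R₁.new (T₁.i! γ∈ h))))
              (λ γ∈ h → inj₁ (cong R₂.new (T₂.i! γ∈ h)))
              (λ ¬inc₁ ¬inc₂ → trans (Single.kept (thread-single r₂) ¬inc₂) (Single.kept (thread-single r₁) ¬inc₁))
        where
        module T₁ = Thread T₁
        module T₂ = Thread T₂
        i₁≢i₂ : T₁.i ≢ T₂.i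
        i₁≢i₂ eq = x₁≢x₂ (trans (sym T₁.hd-i) (trans (cong hd eq) T₂.hd-i))
        o₁≢o₂ : T₁.o ≢ T₂.o
        o₁≢o₂ eq = x₁≢x₂ (trans (sym T₁.tl-o) (trans (cong tl eq) T₂.tl-o))
        r₁ : Reached col (tl e₁) T₁
        r₁ = reach good T₁ ok₁
        module R₁ = Reached r₁
        ok₂′ : Unblocked R₁.new (inj₂ T₂)
        ok₂′ rewrite R₁.kept (i₁≢i₂ ∘ sym) (o₁≢i₂ ∘ sym) | R₁.kept o₂≢i₁ (o₁≢o₂ ∘ sym) = ok₂
        r₂ : Reached R₁.new (tl e₂) T₂
        r₂ = reach R₁.good T₂ ok₂′
        module R₂ = Reached r₂

    -- Choosing the colours after the leaving arcs

    module OutPhase {k : ℕ} (3≤k : 3 ≤ k) where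

      record Choice (col : Fin m → Fin k) (f₁ f₂ : Fin m) : Set where
        constructor choice
        field
          new     : Fin m → Fin k
          good    : Good Q new
          λ₁ λ₂   : Fin k
          covers₁ : CoversOut new f₁ λ₁
          covers₂ : CoversOut new f₂ λ₂

      Suits : ∀ {col f₁ f₂ x} → Choice col f₁ f₂ → NoOut Q x ⊎ Thread Q x → Set
      Suits c s = InPhase.Unblocked 3≤k (Choice.λ₁ c) (Choice.λ₂ c) (Choice.new c) s

      -- Blocking takes two different forbidden colours, and here there is only one.
      single-colour : ∀ {κ x} {col : Fin m → Fin k} (s : NoOut Q x ⊎ Thread Q x) → InPhase.Unblocked 3≤k κ κ col s
      single-colour (inj₁ _) = tt
      single-colour {κ} {col = col} (inj₂ T) with col (Thread.i T) ≟ κ | col (Thread.o T) ≟ κ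
      ... | yes p | yes q = inj₁ (trans p (sym q))
      ... | no ¬p | _     = inj₂ (inj₁ (¬p , ¬p))
      ... | yes _ | no ¬q = inj₂ (inj₂ (¬q , ¬q))

      -- The three choices of out-colours made available by swapping the colours of at most one of two
      -- threads coloured p₁, q₁ and p₂, q₂.
      module Options {p₁ q₁ p₂ q₂ : Fin k} (p₁≢q₁ : p₁ ≢ q₁) (p₂≢q₂ : p₂ ≢ q₂) (q₁≢q₂ : q₁ ≢ q₂)
                     (p₁≢q₂ : p₁ ≢ q₂) (p₂≢q₁ : p₂ ≢ q₁) (p₁≢p₂ : p₁ ≢ p₂) where

        l₁ l₂ : Fin 3 → Fin k
        l₁ zero             = q₁
        l₁ (suc zero)       = p₁
        l₁ (suc (suc zero)) = q₁
        l₂ zero             = q₂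
        l₂ (suc zero)       = q₂
        l₂ (suc (suc zero)) = p₂

        Fits : Fin k → Fin k → Fin 3 → Set
        Fits s t j = s ≡ t ⊎ (s ≢ l₁ j × s ≢ l₂ j) ⊎ (t ≢ l₁ j × t ≢ l₂ j)

        -- With at most one exception each, two properties of the three options hold together for
        -- some option.
        AllBut : (Fin 3 → Set) → Set
        AllBut A = ∃ λ j₀ → ∀ j → j ≢ j₀ → A j

        not-0 : ∀ {A : Fin 3 → Set} → A (suc zero) → A (suc (suc zero)) → AllBut A
        not-0 a₁ a₂ = zero , λ { zero j≢ → ⊥-elim (j≢ refl) ; (suc zero) _ → a₁ ; (suc (suc zero)) _ → a₂ }

        not-1 : ∀ {A : Fin 3 → Set} → A zero → A (suc (suc zero)) → AllBut A
        not-1 a₀ a₂ = suc zero , λ { zero _ → a₀ ; (suc zero) j≢ → ⊥-elim (j≢ refl) ; (suc (suc zero)) _ → a₂ }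

        not-2 : ∀ {A : Fin 3 → Set} → A zero → A (suc zero) → AllBut A
        not-2 a₀ a₁ = suc (suc zero) , λ { zero _ → a₀ ; (suc zero) _ → a₁ ; (suc (suc zero)) j≢ → ⊥-elim (j≢ refl) }

        -- A pair can only be blocked by a choice whose two colours it consists of.
        all-but-one-fits : ∀ s t → AllBut (Fits s t)
        all-but-one-fits s t with s ≟ q₁ | s ≟ q₂ | s ≟ p₁ | t ≟ q₁ | t ≟ q₂
        ... | yes refl | _ | _ | _ | yes refl =
              not-0 (inj₂ (inj₁ (p₁≢q₁ ∘ sym , q₁≢q₂))) (inj₂ (inj₂ (q₁≢q₂ ∘ sym , p₂≢q₂ ∘ sym)))
        ... | yes refl | _ | _ | yes refl | no _ =
              not-0 (inj₁ refl) (inj₁ refl)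
        ... | yes refl | _ | _ | no t≢q₁ | no t≢q₂ =
              not-2 (inj₂ (inj₂ (t≢q₁ , t≢q₂))) (inj₂ (inj₁ (p₁≢q₁ ∘ sym , q₁≢q₂)))
        ... | no _ | yes refl | _ | yes refl | _ =
              not-0 (inj₂ (inj₂ (p₁≢q₁ ∘ sym , q₁≢q₂))) (inj₂ (inj₁ (q₁≢q₂ ∘ sym , p₂≢q₂ ∘ sym)))
        ... | no _ | yes refl | _ | no _ | yes refl =
              not-0 (inj₁ refl) (inj₁ refl)
        ... | no _ | yes refl | _ | no t≢q₁ | no t≢q₂ =
              not-1 (inj₂ (inj₂ (t≢q₁ , t≢q₂))) (inj₂ (inj₁ (q₁≢q₂ ∘ sym , p₂≢q₂ ∘ sym)))
        ... | no s≢q₁ | no s≢q₂ | yes refl | _ | _ =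
              not-1 (inj₂ (inj₁ (s≢q₁ , s≢q₂))) (inj₂ (inj₁ (p₁≢q₁ , p₁≢p₂)))
        ... | no s≢q₁ | no s≢q₂ | no s≢p₁ | _ | _ =
              not-2 (inj₂ (inj₁ (s≢q₁ , s≢q₂))) (inj₂ (inj₁ (s≢p₁ , s≢q₂)))

      module _ {col : Fin m → Fin k} (good : Good Q col) where

        Agreed : Fin m → Fin m → Set
        Agreed f₁ f₂ = ∃ λ (new : Fin m → Fin k) → Good Q new × ∃ λ κ → CoversOut new f₁ κ × CoversOut new f₂ κ

        flip-agreed : ∀ {f₁ f₂} → Agreed f₁ f₂ → Agreed f₂ f₁
        flip-agreed (new , good , κ , c₁ , c₂) = new , good , κ , c₂ , c₁

        single-out : ∀ {y} → NoIn Q y ⊎ Thread Q y →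
          ∃ λ (new : Fin m → Fin k) → Good Q new × ∃ λ κ → ∀ {γ} → γ ∈ Q → tl γ ≡ y → new γ ≡ κ
        single-out {y} (inj₁ dead) = _ , recolour-out good dead κ , κ , λ _ t → paint-yes (λ γ → tl γ ≟ y) κ col t
          where κ = fromℕ< (ℕ.≤-trans (s≤s z≤n) 3≤k)
        single-out (inj₂ T) = col , good , col o , λ γ∈ t → cong col (o! γ∈ t)
          where open Thread T

        one-free-out : ∀ {f₁ f₂} → hd f₁ ≢ hd f₂ → NoIn Q (hd f₁) → NoIn Q (hd f₂) ⊎ Thread Q (hd f₂) → Agreed f₁ f₂
        one-free-out {f₁} y₁≢y₂ dead s with single-out s
        ... | new , good′ , κ , covers = paint (λ γ → tl γ ≟ hd f₁) κ new , recolour-out good′ dead κ , κ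
          , (λ _ t → inj₁ (paint-yes (λ γ → tl γ ≟ hd f₁) κ new t))
          , (λ γ∈ t → inj₁ (trans (paint-no (λ γ → tl γ ≟ hd f₁) κ new (λ t′ → y₁≢y₂ (trans (sym t′) t))) (covers γ∈ t)))

        -- The first thread runs into the second, so the out-arc of the second one covers both sides
        -- without any recolouring.
        chained-out : ∀ {f₁ f₂} → Leaves f₂ → (T₁ : Thread Q (hd f₁)) (T₂ : Thread Q (hd f₂)) →
          Thread.o T₁ ≡ Thread.i T₂ → Agreed f₁ f₂
        chained-out le₂ T₁ T₂ o₁≡i₂ = col , good , col (Thread.o T₂)
          , (λ γ∈ t → inj₂ (_ , le₂ , trans (cong hd (trans (Thread.o! T₁ γ∈ t) o₁≡i₂)) (Thread.hd-i T₂)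
                          , λ δ∈ t′ → cong col (Thread.o! T₂ δ∈ t′)))
          , (λ γ∈ t → inj₁ (cong col (Thread.o! T₂ γ∈ t)))

        module TwoThreads {f₁ f₂} (y₁≢y₂ : hd f₁ ≢ hd f₂) (T₁ : Thread Q (hd f₁)) (T₂ : Thread Q (hd f₂))
                          (o₁≢i₂ : Thread.o T₁ ≢ Thread.i T₂) (o₂≢i₁ : Thread.o T₂ ≢ Thread.i T₁) where

          module T₁ = Thread T₁
          module T₂ = Thread T₂

          o₁≢o₂ : T₁.o ≢ T₂.o
          o₁≢o₂ eq = y₁≢y₂ (trans (sym T₁.tl-o) (trans (cong tl eq) T₂.tl-o))

          covers-o₁ : ∀ (new : Fin m → Fin k) {κ} → new T₁.o ≡ κ → CoversOut new f₁ κ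
          covers-o₁ new eq γ∈ t = inj₁ (trans (cong new (T₁.o! γ∈ t)) eq)

          covers-o₂ : ∀ (new : Fin m → Fin k) {κ} → new T₂.o ≡ κ → CoversOut new f₂ κ
          covers-o₂ new eq γ∈ t = inj₁ (trans (cong new (T₂.o! γ∈ t)) eq)

          p₁ q₁ p₂ q₂ : Fin k
          p₁ = col T₁.i
          q₁ = col T₁.o
          p₂ = col T₂.i
          q₂ = col T₂.o

          module Swap₁ = Repaint noLoop T₁ q₁ p₁ col
          module Swap₂ = Repaint noLoop T₂ q₂ p₂ col

          swapped₁ swapped₂ : Fin m → Fin k
          swapped₁ = repaint T₁ q₁ p₁ col
          swapped₂ = repaint T₂ q₂ p₂ col

          -- If `p₁` is `q₂`, this is a swap on the first thread. If `p₁` is `q₁`, the in-arc alone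
          -- keeps the repeated colour and the out-arc may take `q₂`.
          agree-by-first : p₁ ≡ q₁ ⊎ p₁ ≡ q₂ → Agreed f₁ f₂
          agree-by-first p₁∈ = repaint T₁ q₁ q₂ col , R.good good p₁∈ (inj₁ refl) , q₂
            , covers-o₁ (repaint T₁ q₁ q₂ col) R.at-o , covers-o₂ (repaint T₁ q₁ q₂ col) (R.elsewhere o₂≢i₁ (o₁≢o₂ ∘ sym))
            where module R = Repaint noLoop T₁ q₁ q₂ col

          agree-by-second : p₂ ≡ q₂ ⊎ p₂ ≡ q₁ → Agreed f₁ f₂
          agree-by-second p₂∈ = repaint T₂ q₂ q₁ col , R.good good p₂∈ (inj₁ refl) , q₁
            , covers-o₁ (repaint T₂ q₂ q₁ col) (R.elsewhere o₁≢i₂ o₁≢o₂) , covers-o₂ (repaint T₂ q₂ q₁ col) R.at-o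
            where module R = Repaint noLoop T₂ q₂ q₁ col

          i₁≢i₂ : T₁.i ≢ T₂.i
          i₁≢i₂ eq = y₁≢y₂ (trans (sym T₁.hd-i) (trans (cong hd eq) T₂.hd-i))

          -- Swapping on both threads brings the common in-colour to both out-arcs.
          agree-by-both : p₁ ≡ p₂ → Agreed f₁ f₂
          agree-by-both p₁≡p₂ = both , R.good (Swap₁.good good (inj₂ refl) (inj₁ refl))
              (inj₂ (Swap₁.elsewhere (i₁≢i₂ ∘ sym) (o₁≢i₂ ∘ sym)))
              (inj₁ (Swap₁.elsewhere o₂≢i₁ (o₁≢o₂ ∘ sym))) , p₁
            , covers-o₁ both (trans (R.elsewhere o₁≢i₂ o₁≢o₂) Swap₁.at-o)
            , covers-o₂ both (trans R.at-o (sym p₁≡p₂))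
            where
            both : Fin m → Fin k
            both = repaint T₂ q₂ p₂ swapped₁
            module R = Repaint noLoop T₂ q₂ p₂ swapped₁

          module Disagree (p₁≢q₁ : p₁ ≢ q₁) (p₂≢q₂ : p₂ ≢ q₂) (q₁≢q₂ : q₁ ≢ q₂)
                          (p₁≢q₂ : p₁ ≢ q₂) (p₂≢q₁ : p₂ ≢ q₁) (p₁≢p₂ : p₁ ≢ p₂) where

            open Options p₁≢q₁ p₂≢q₂ q₁≢q₂ p₁≢q₂ p₂≢q₁ p₁≢p₂

            option : Fin 3 → Choice col f₁ f₂
            option zero = choice col good q₁ q₂ (covers-o₁ col refl) (covers-o₂ col refl)
            option (suc zero) = choice swapped₁ (Swap₁.good good (inj₂ refl) (inj₁ refl)) p₁ q₂
              (covers-o₁ swapped₁ Swap₁.at-o) (covers-o₂ swapped₁ (Swap₁.elsewhere o₂≢i₁ (o₁≢o₂ ∘ sym)))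
            option (suc (suc zero)) = choice swapped₂ (Swap₂.good good (inj₂ refl) (inj₁ refl)) q₁ p₂
              (covers-o₁ swapped₂ (Swap₂.elsewhere o₁≢i₂ o₁≢o₂)) (covers-o₂ swapped₂ Swap₂.at-o)

            module _ {e} (x≢y₁ : tl e ≢ hd f₁) (x≢y₂ : tl e ≢ hd f₂)
                     (no-y₁→x : ∀ γ → tl γ ≡ hd f₁ → hd γ ≢ tl e) (no-y₂→x : ∀ γ → tl γ ≡ hd f₂ → hd γ ≢ tl e) where

              module _ (T : Thread Q (tl e)) where

                open Thread T

                recoloured : Fin 3 → Fin m → Fin k
                recoloured = Choice.new ∘ option

                -- The swaps affect only arcs at the heads of `f₁` and `f₂`. None of these arcs
                -- enters the tail of `e`: that tail is neither head, and no arc leads to it from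
                -- either head.
                i-kept : ∀ j → recoloured j i ≡ col i
                i-kept zero             = refl
                i-kept (suc zero)       = Swap₁.elsewhere (λ { refl → x≢y₁ (trans (sym hd-i) T₁.hd-i) })
                                                         (λ { refl → no-y₁→x i T₁.tl-o hd-i })
                i-kept (suc (suc zero)) = Swap₂.elsewhere (λ { refl → x≢y₂ (trans (sym hd-i) T₂.hd-i) })
                                                         (λ { refl → no-y₂→x i T₂.tl-o hd-i })

                suits-if : ∀ j {t} → recoloured j o ≡ t → Fits (col i) t j → Suits (option j) (inj₂ T)
                suits-if j {t} refl fits with subst (λ s → Fits s t j) (sym (i-kept j)) fits
                suits-if zero             refl _ | fits = fits
                suits-if (suc zero)       refl _ | fits = fits
                suits-if (suc (suc zero)) refl _ | fits = fits

                o≢o₁ : o ≢ T₁.o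
                o≢o₁ refl = x≢y₁ (trans (sym tl-o) T₁.tl-o)

                o≢o₂ : o ≢ T₂.o
                o≢o₂ refl = x≢y₂ (trans (sym tl-o) T₂.tl-o)

                -- If o leads into f₁'s or f₂'s thread, it always bears the colour not chosen there.
                thread-suits : Dec (o ≡ T₁.i) → Dec (o ≡ T₂.i) → AllBut λ j → Suits (option j) (inj₂ T)
                thread-suits (yes refl) _ = not-0 {λ j → Suits (option j) (inj₂ T)}
                  (suits-if (suc zero) Swap₁.at-i (inj₂ (inj₂ (p₁≢q₁ ∘ sym , q₁≢q₂))))
                  (suits-if (suc (suc zero)) (Swap₂.elsewhere i₁≢i₂ (o₂≢i₁ ∘ sym)) (inj₂ (inj₂ (p₁≢q₁ , p₁≢p₂))))
                thread-suits (no _) (yes refl) = not-0 {λ j → Suits (option j) (inj₂ T)}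
                  (suits-if (suc zero) (Swap₁.elsewhere (i₁≢i₂ ∘ sym) (o₁≢i₂ ∘ sym)) (inj₂ (inj₂ (p₁≢p₂ ∘ sym , p₂≢q₂))))
                  (suits-if (suc (suc zero)) Swap₂.at-i (inj₂ (inj₂ (q₁≢q₂ ∘ sym , p₂≢q₂ ∘ sym))))
                thread-suits (no o≢i₁) (no o≢i₂) =
                  let j₀ , fits = all-but-one-fits (col i) (col o) in j₀ , λ j j≢ → suits-if j (o-kept j) (fits j j≢)
                  where
                  o-kept : ∀ j → recoloured j o ≡ col o
                  o-kept zero             = refl
                  o-kept (suc zero)       = Swap₁.elsewhere o≢i₁ o≢o₁
                  o-kept (suc (suc zero)) = Swap₂.elsewhere o≢i₂ o≢o₂

              suits : (s : NoOut Q (tl e) ⊎ Thread Q (tl e)) → AllBut λ j → Suits (option j) s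
              suits (inj₁ _) = zero , λ _ _ → tt
              suits (inj₂ T) = thread-suits T (Thread.o T ≟ T₁.i) (Thread.o T ≟ T₂.i)

        module _ (noTriangle : ∀ {α β} → Enters α → Leaves β → hd β ≢ tl α)
                 (noSquare : ∀ {α β} → Enters α → Leaves β → ∀ γ → tl γ ≡ hd β → hd γ ≢ tl α)
                 {e₁ e₂ f₁ f₂} (en₁ : Enters e₁) (en₂ : Enters e₂) (le₁ : Leaves f₁) (le₂ : Leaves f₂)
                 (s₁ : NoOut Q (tl e₁) ⊎ Thread Q (tl e₁)) (s₂ : NoOut Q (tl e₂) ⊎ Thread Q (tl e₂)) where

          Suitable : Set
          Suitable = ∃ λ (c : Choice col f₁ f₂) → Suits c s₁ × Suits c s₂

          agreed-suitable : Agreed f₁ f₂ → Suitable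
          agreed-suitable (new , good′ , κ , c₁ , c₂) = choice new good′ κ κ c₁ c₂ , single-colour s₁ , single-colour s₂

          two-threads : hd f₁ ≢ hd f₂ → Thread Q (hd f₁) → Thread Q (hd f₂) → Suitable
          two-threads y₁≢y₂ T₁ T₂ with Thread.o T₁ ≟ Thread.i T₂ | Thread.o T₂ ≟ Thread.i T₁
          ... | yes o₁≡i₂ | _ = agreed-suitable (chained-out le₂ T₁ T₂ o₁≡i₂)
          ... | no _ | yes o₂≡i₁ = agreed-suitable (flip-agreed (chained-out le₁ T₂ T₁ o₂≡i₁))
          -- Any coincidence among the four thread colours makes a single out-colour possible.
          -- Otherwise the four are pairwise different and the three options come into play.
          ... | no o₁≢i₂ | no o₂≢i₁ = choose (p₁ ≟ q₁) (p₂ ≟ q₂) (q₁ ≟ q₂) (p₁ ≟ q₂) (p₂ ≟ q₁) (p₁ ≟ p₂)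
            where
            open TwoThreads y₁≢y₂ T₁ T₂ o₁≢i₂ o₂≢i₁
            choose : Dec (p₁ ≡ q₁) → Dec (p₂ ≡ q₂) → Dec (q₁ ≡ q₂) → Dec (p₁ ≡ q₂) → Dec (p₂ ≡ q₁) → Dec (p₁ ≡ p₂) → Suitable
            choose (yes eq) _ _ _ _ _ = agreed-suitable (agree-by-first (inj₁ eq))
            choose _ (yes eq) _ _ _ _ = agreed-suitable (agree-by-second (inj₁ eq))
            choose _ _ (yes eq) _ _ _ = agreed-suitable (col , good , q₁ , covers-o₁ col refl , covers-o₂ col (sym eq))
            choose _ _ _ (yes eq) _ _ = agreed-suitable (agree-by-first (inj₂ eq))
            choose _ _ _ _ (yes eq) _ = agreed-suitable (agree-by-second (inj₂ eq))
            choose _ _ _ _ _ (yes eq) = agreed-suitable (agree-by-both eq)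
            choose (no n₁) (no n₂) (no n₃) (no n₄) (no n₅) (no n₆) =
              pick (suits (noTriangle en₁ le₁ ∘ sym) (noTriangle en₁ le₂ ∘ sym) (noSquare en₁ le₁) (noSquare en₁ le₂) s₁)
                   (suits (noTriangle en₂ le₁ ∘ sym) (noTriangle en₂ le₂ ∘ sym) (noSquare en₂ le₁) (noSquare en₂ le₂) s₂)
              where
              open Disagree n₁ n₂ n₃ n₄ n₅ n₆
              pick : (∃ λ j₀ → ∀ j → j ≢ j₀ → Suits (option j) s₁) → (∃ λ j₀ → ∀ j → j ≢ j₀ → Suits (option j) s₂) → Suitable
              -- Each entering tail rules out at most one of the three options, so one option suits
              -- both.
              pick (i₀ , fits₁) (j₀ , fits₂) with fresh (i₀ ∷ j₀ ∷ []) (s≤s (s≤s (s≤s z≤n)))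
              ... | j , j∉ = option j , fits₁ j (λ { refl → j∉ (here refl) }) , fits₂ j (λ { refl → j∉ (there (here refl)) })

          out-phase : NoIn Q (hd f₁) ⊎ Thread Q (hd f₁) → NoIn Q (hd f₂) ⊎ Thread Q (hd f₂) → Suitable
          out-phase t₁ t₂ with hd f₁ ≟ hd f₂
          ... | yes eq = agreed-suitable (let new , good′ , κ , covers = single-out t₁ in
                  new , good′ , κ , (λ γ∈ t → inj₁ (covers γ∈ t)) , λ γ∈ t → inj₁ (covers γ∈ (trans t (sym eq))))
          out-phase (inj₁ dead) t₂ | no y₁≢y₂ = agreed-suitable (one-free-out y₁≢y₂ dead t₂)
          out-phase t₁@(inj₂ _) (inj₁ dead) | no y₁≢y₂ = agreed-suitable (flip-agreed (one-free-out (y₁≢y₂ ∘ sym) dead t₁))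
          out-phase (inj₂ T₁) (inj₂ T₂) | no y₁≢y₂ = two-threads y₁≢y₂ T₁ T₂

    -- The inductive steps for three, four and five colours

    Result : ℕ → Set
    Result k = ∃ λ (col : Fin m → Fin k) → Good P col

    three-step : {col : Fin m → Fin 3} → Good Q col → Result 3
    three-step {col} good = extended-good good (λ _ → zero) (λ _ → suc zero) (suc (suc zero))
      λ {_} {_} {c} _ _ ≢0 ≢2 ≢1 _ → absurd c ≢0 ≢2 ≢1
      where
      absurd : (c : Fin 3) → c ≢ zero → c ≢ suc (suc zero) → c ≢ suc zero → ⊥
      absurd zero             ≢0 _  _  = ≢0 refl
      absurd (suc zero)       _  _  ≢1 = ≢1 refl
      absurd (suc (suc zero)) _  ≢2 _  = ≢2 refl

    module Ends {k : ℕ} {e₁ e₂ : Fin m} (ε₁ ε₂ : Fin k) where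

      assign : Fin m → Fin k
      assign = paint (_≟ e₁) ε₁ (λ _ → ε₂)

      -- Since the property is given at both ends, it also holds when `e₁` and `e₂` coincide and
      -- `ε₁` prevails.
      assigned : ∀ {α} {A : Fin m → Fin k → Set} → α ≡ e₁ ⊎ α ≡ e₂ → A e₁ ε₁ → A e₂ ε₂ → A α (assign α)
      assigned {α} one-of A₁ A₂ with α ≟ e₁ | one-of
      ... | yes refl | _         = A₁
      ... | no α≢    | inj₁ eq   = ⊥-elim (α≢ eq)
      ... | no _     | inj₂ refl = A₂

    Splits : ∀ {k} → Fin k → Fin k → Fin k → Fin k → Set
    Splits u v κ ε = (κ ≡ u × ε ≡ v) ⊎ (κ ≡ v × ε ≡ u)

    -- The end arcs are coloured so that on either side the walk colour `κᵢ` and the end colour `εᵢ`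
    -- together make up the same pair `u`, `v`. Different walk colours are exchanged; equal ones are
    -- completed by a fresh colour, for which `short` leaves room.
    split : ∀ {k} (L : List (Fin k)) {κ₁ κ₂} → κ₁ ∉ L → κ₂ ∉ L → suc (length L) < k →
      ∃ λ u → ∃ λ v → u ∉ L × v ∉ L × u ≢ v × ∃ λ ε₁ → ∃ λ ε₂ → Splits u v κ₁ ε₁ × Splits u v κ₂ ε₂
    split L {κ₁} {κ₂} κ₁∉ κ₂∉ short with κ₁ ≟ κ₂
    ... | no κ₁≢κ₂ = κ₁ , κ₂ , κ₁∉ , κ₂∉ , κ₁≢κ₂ , κ₂ , κ₁ , inj₁ (refl , refl) , inj₂ (refl , refl)
    ... | yes refl with fresh (κ₁ ∷ L) short
    ...   | v , v∉ = κ₁ , v , κ₁∉ , v∉ ∘ there , (λ { refl → v∉ (here refl) })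
                , v , v , inj₁ (refl , refl) , inj₁ (refl , refl)

    split-uses : ∀ {k} {u v κ ε c : Fin k} → Splits u v κ ε → c ≡ u ⊎ c ≡ v → c ≢ ε → c ≡ κ
    split-uses (inj₁ (refl , refl)) (inj₁ eq) _   = eq
    split-uses (inj₁ (refl , refl)) (inj₂ eq) c≢ε = ⊥-elim (c≢ε eq)
    split-uses (inj₂ (refl , refl)) (inj₁ eq) c≢ε = ⊥-elim (c≢ε eq)
    split-uses (inj₂ (refl , refl)) (inj₂ eq) _   = eq

    module _ (noTriangle : ∀ {α β} → Enters α → Leaves β → hd β ≢ tl α) where

      four-step : {col : Fin m → Fin 4} → Good Q col → Result 4
      four-step {col} good with in-arcs
      ... | e₁ , e₂ , en₁ , en₂ , ins = finish
            (in-phase good en₁ en₂ s₁ s₂ (unblocked s₁) (unblocked s₂))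
        where
        -- Both forbidden colours are `zero`, which is reserved for the leaving arcs.
        open InPhase {4} (s≤s (s≤s (s≤s z≤n))) zero zero
        s₁ = in-side en₁
        s₂ = in-side en₂

        unblocked : ∀ {x} (s : NoOut Q x ⊎ Thread Q x) → Unblocked col s
        unblocked = OutPhase.single-colour (s≤s (s≤s (s≤s z≤n)))

        finish : Outcome col e₁ e₂ → Result 4
        finish (outcome new good′ μ₁ μ₂ (μ₁≢0 , _) (μ₂≢0 , _) covers₁ covers₂ _)
          with split (zero ∷ []) (λ { (here eq) → μ₁≢0 eq }) (λ { (here eq) → μ₂≢0 eq }) (s≤s (s≤s (s≤s z≤n)))
        ... | u , v , u∉ , v∉ , u≢v , ε₁ , ε₂ , split₁ , split₂ with fresh (u ∷ v ∷ zero ∷ []) (s≤s (s≤s (s≤s (s≤s z≤n))))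
        ...   | ρ , ρ∉ = extended-good good′ assign (λ _ → zero) ρ cut
          where
          open Ends {e₁ = e₁} {e₂} ε₁ ε₂
          palette : ∀ c → c ∈ ρ ∷ u ∷ v ∷ zero ∷ []
          palette = unique-full (All.tabulate (λ {c} c∈ → λ { refl → ρ∉ c∈ })
            ∷ (u≢v ∷ (λ { refl → u∉ (here refl) }) ∷ []) ∷ ((λ { refl → v∉ (here refl) }) ∷ []) ∷ [] ∷ []) refl
          cut : CutPair new assign (λ _ → zero) ρ
          cut {α} {β} {c} en le c≢ε c≢ρ c≢0 w = case (palette c)
            where
            seen : c ≡ u ⊎ c ≡ v → ⊥
            seen c∈ = assigned {A = λ α ε → Enters α → c ≢ ε → Walk (Avoiding Q new c) (hd β) (tl α) → ⊥} (ins en)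
              (λ en c≢ → covered-in new noTriangle en le
                (subst (CoversIn new e₁) (sym (split-uses split₁ c∈ c≢)) covers₁))
              (λ en c≢ → covered-in new noTriangle en le
                (subst (CoversIn new e₂) (sym (split-uses split₂ c∈ c≢)) covers₂)) en c≢ε w
            case : c ∈ ρ ∷ u ∷ v ∷ zero ∷ [] → ⊥
            case (here eq)                         = c≢ρ eq
            case (there (here eq))                 = seen (inj₁ eq)
            case (there (there (here eq)))         = seen (inj₂ eq)
            case (there (there (there (here eq)))) = c≢0 eq

      module _ (noSquare : ∀ {α β} → Enters α → Leaves β → ∀ γ → tl γ ≡ hd β → hd γ ≢ tl α) where

        -- The colours after the leaving arcs are settled first, in such a way that both entering
        -- sides remain unblocked. The colours before the entering arcs are then chosen to avoid
        -- them.
        five-step : {col : Fin m → Fin 5} → Good Q col → Result 5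
        five-step {col} good with in-arcs | out-arcs
        ... | e₁ , e₂ , en₁ , en₂ , ins | f₁ , f₂ , le₁ , le₂ , outs =
              from-choice (out-phase good noTriangle noSquare en₁ en₂ le₁ le₂ s₁ s₂ (out-side le₁) (out-side le₂))
          where
          3≤5 : 3 ≤ 5
          3≤5 = s≤s (s≤s (s≤s z≤n))
          open OutPhase 3≤5
          s₁ = in-side en₁
          s₂ = in-side en₂

          from-choice : (∃ λ (c : Choice col f₁ f₂) → Suits c s₁ × Suits c s₂) → Result 5
          from-choice (choice mid good′ λ₁ λ₂ out₁ out₂ , ok₁ , ok₂) = finish (in-phase good′ en₁ en₂ s₁ s₂ ok₁ ok₂)
            where
            open InPhase 3≤5 λ₁ λ₂

            finish : Outcome mid e₁ e₂ → Result 5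
            finish (outcome new good″ μ₁ μ₂ (μ₁≢λ₁ , μ₁≢λ₂) (μ₂≢λ₁ , μ₂≢λ₂) covers₁ covers₂ kept)
              with split (λ₁ ∷ λ₂ ∷ []) (avoid μ₁≢λ₁ μ₁≢λ₂) (avoid μ₂≢λ₁ μ₂≢λ₂) (s≤s (s≤s (s≤s (s≤s z≤n))))
              where
              avoid : ∀ {μ} → μ ≢ λ₁ → μ ≢ λ₂ → μ ∉ λ₁ ∷ λ₂ ∷ []
              avoid ≢₁ ≢₂ (here eq)         = ≢₁ eq
              avoid ≢₁ ≢₂ (there (here eq)) = ≢₂ eq
            ... | u , v , u∉ , v∉ , u≢v , ε₁ , ε₂ , split₁ , split₂
              -- The colours `λ₁`, `λ₂` lie outside `u`, `v`, so the leaving side obtains a pair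
              -- `u′`, `v′` disjoint from that of the entering side. The fifth colour goes to the
              -- root.
              with split (u ∷ v ∷ [])
                     {λ₁} {λ₂}
                     (λ { (here refl) → u∉ (here refl) ; (there (here refl)) → v∉ (here refl) })
                     (λ { (here refl) → u∉ (there (here refl)) ; (there (here refl)) → v∉ (there (here refl)) })
                     (s≤s (s≤s (s≤s (s≤s z≤n))))
            ...   | u′ , v′ , u′∉ , v′∉ , u′≢v′ , φ₁ , φ₂ , split₁′ , split₂′
              with fresh (u ∷ v ∷ u′ ∷ v′ ∷ []) (s≤s (s≤s (s≤s (s≤s (s≤s z≤n)))))
            ...     | ρ , ρ∉ = extended-good good″ ε φ ρ cut
              where
              module I = Ends {e₁ = e₁} {e₂} ε₁ ε₂
              module O = Ends {e₁ = f₁} {f₂} φ₁ φ₂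
              ε φ : Fin m → Fin 5
              ε = I.assign
              φ = O.assign

              -- By `noTriangle` and `noSquare`, an arc starting at the head of a leaving arc
              -- touches no tail of an entering arc, so the second phase has not changed it.
              out-kept : ∀ {β} → Leaves β → ∀ {γ} → tl γ ≡ hd β → new γ ≡ mid γ
              out-kept le {γ} t = kept (apart en₁) (apart en₂)
                where
                apart : ∀ {e} → Enters e → ¬ Incident (tl e) γ
                apart en (inj₁ t′) = noTriangle en le (trans (sym t) t′)
                apart en (inj₂ h)  = noSquare en le γ t h

              out-covers : ∀ {f κ} → Leaves f → CoversOut mid f κ → CoversOut new f κ
              out-covers le cov γ∈ t with cov γ∈ t
              ... | inj₁ eq = inj₁ (trans (out-kept le t) eq)
              ... | inj₂ (β′ , le′ , h , cov′) = inj₂ (β′ , le′ , h , λ δ∈ t′ → trans (out-kept le′ t′) (cov′ δ∈ t′))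

              palette : ∀ c → c ∈ ρ ∷ u ∷ v ∷ u′ ∷ v′ ∷ []
              palette = unique-full (All.tabulate (λ {c} c∈ → λ { refl → ρ∉ c∈ })
                ∷ (u≢v ∷ (λ { refl → u′∉ (here refl) }) ∷ (λ { refl → v′∉ (here refl) }) ∷ [])
                ∷ ((λ { refl → u′∉ (there (here refl)) }) ∷ (λ { refl → v′∉ (there (here refl)) }) ∷ [])
                ∷ (u′≢v′ ∷ []) ∷ [] ∷ []) refl

              cut : CutPair new ε φ ρ
              cut {α} {β} {c} en le c≢ε c≢ρ c≢φ w = case (palette c)
                where
                seen-in : c ≡ u ⊎ c ≡ v → ⊥
                seen-in c∈ = I.assigned {A = λ α ε → Enters α → c ≢ ε → Walk (Avoiding Q new c) (hd β) (tl α) → ⊥} (ins en)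
                  (λ en c≢ → covered-in new noTriangle en le
                    (subst (CoversIn new e₁) (sym (split-uses split₁ c∈ c≢)) covers₁))
                  (λ en c≢ → covered-in new noTriangle en le
                    (subst (CoversIn new e₂) (sym (split-uses split₂ c∈ c≢)) covers₂)) en c≢ε w
                seen-out : c ≡ u′ ⊎ c ≡ v′ → ⊥
                seen-out c∈ = O.assigned {A = λ β φ → Leaves β → c ≢ φ → Walk (Avoiding Q new c) (hd β) (tl α) → ⊥} (outs le)
                  (λ le c≢ → covered-out new noTriangle en le
                    (subst (CoversOut new f₁) (sym (split-uses split₁′ c∈ c≢)) (out-covers le out₁)))
                  (λ le c≢ → covered-out new noTriangle en le
                    (subst (CoversOut new f₂) (sym (split-uses split₂′ c∈ c≢)) (out-covers le out₂))) le c≢φ w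
                case : c ∈ ρ ∷ u ∷ v ∷ u′ ∷ v′ ∷ [] → ⊥
                case (here eq)                                 = c≢ρ eq
                case (there (here eq))                         = seen-in (inj₁ eq)
                case (there (there (here eq)))                 = seen-in (inj₂ eq)
                case (there (there (there (here eq))))         = seen-out (inj₁ eq)
                case (there (there (there (there (here eq))))) = seen-out (inj₂ eq)

-- Directed cycles

rotate : ∀ {k} → ℕ → Fin (suc k) → Fin (suc k)
rotate zero    i = i
rotate (suc j) i = rotate j (next i)

toℕ-rotate : ∀ {k} j (i : Fin (suc k)) → toℕ (rotate j i) ≡ (toℕ i + j) % suc k
toℕ-rotate {k} zero i = sym (trans (cong (_% suc k) (ℕ.+-identityʳ (toℕ i))) (m<n⇒m%n≡m (toℕ<n i)))
toℕ-rotate {k} (suc j) i = begin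
  toℕ (rotate j (next i))                        ≡⟨ toℕ-rotate j (next i) ⟩
  (toℕ (next i) + j) % suc k                     ≡⟨ cong (λ t → (t + j) % suc k) (toℕ-fromℕ< (m%n<n (suc (toℕ i)) (suc k))) ⟩
  (suc (toℕ i) % suc k + j) % suc k              ≡⟨ %-distribˡ-+ (suc (toℕ i) % suc k) j (suc k) ⟩
  (suc (toℕ i) % suc k % suc k + j % suc k) % suc k
    ≡⟨ cong (λ t → (t + j % suc k) % suc k) (m%n%n≡m%n (suc (toℕ i)) (suc k)) ⟩
  (suc (toℕ i) % suc k + j % suc k) % suc k      ≡⟨ %-distribˡ-+ (suc (toℕ i)) j (suc k) ⟨
  (suc (toℕ i) + j) % suc k                      ≡⟨ cong (_% suc k) (ℕ.+-suc (toℕ i) j) ⟨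
  (toℕ i + suc j) % suc k                        ∎
  where open ≡-Reasoning

rotate-full : ∀ {k} (i : Fin (suc k)) → rotate (suc k) i ≡ i
rotate-full {k} i = toℕ-injective (trans (toℕ-rotate (suc k) i)
  (trans ([m+n]%n≡m%n (toℕ i) (suc k)) (m<n⇒m%n≡m (toℕ<n i))))

module _ (D : Digraph) where

  open Walks (tail D) (head D)

  -- The first arc is followed by the `k` others, which lead back to its tail because `suc k`
  -- rotation steps are the identity.
  cycle-refutes : ∀ {G k} → Acyclic G → ¬ CycleIn D G k
  cycle-refutes {G} {k} ac C = ac (c zero) (cP zero) (subst₂ (Walk G) (sym (cHead zero))
    (trans (cong v (rotate-full zero)) (sym (cTail zero))) (around k (next zero)))
    where
    open CycleIn C
    around : ∀ j i → Walk G (v i) (v (rotate j i))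
    around zero    i = nil
    around (suc j) i = cons (c i) (cP i) (cTail i) (subst (λ u → Walk G u _) (sym (cHead i)) (around j (next i)))

  good⇒partition : ∀ {t} → (∃ λ (col : Fin (m D) → Fin t) → Good (allFin (m D)) col) → PartitionFAS D t
  good⇒partition (col , good) = col , λ s k → cycle-refutes (acyclic-⊆ (λ {α} ≢s → ∈-allFin α , ≢s) (good s))

  -- The lower bound for oriented graphs of maximum degree three

  module _ (orient : Oriented D) (deg≤3 : MaxDegreeAtMost 3 D) where

    open Oriented orient

    few-arcs : ∀ {v} (ins outs : List (Fin (m D))) → Unique ins → Unique outs →
      All (λ α → head D α ≡ v) ins → All (λ α → tail D α ≡ v) outs → length ins + length outs ≤ 3
    few-arcs {v} ins outs ui uo hs ts = ℕ.≤-trans (ℕ.+-mono-≤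
      (unique-⊆⇒length≤ ui λ {α} α∈ → ∈-filter⁺ (λ a → head D a ≟ v) (∈-allFin α) (All.lookup hs α∈))
      (unique-⊆⇒length≤ uo λ {α} α∈ → ∈-filter⁺ (λ a → tail D a ≟ v) (∈-allFin α) (All.lookup ts α∈))) (deg≤3 v)

    subcubic : Subcubic (tail D) (head D)
    subcubic = record
      { noLoop = noLoop ; no2cyc = no2cyc
      ; in₃out₁ = λ h₁ h₂ h₃ t n₁ n₂ n₃ → 4≰3 (few-arcs _ _ ((n₁ ∷ n₂ ∷ []) ∷ (n₃ ∷ []) ∷ [] ∷ []) ([] ∷ [])
          (h₁ ∷ h₂ ∷ h₃ ∷ []) (t ∷ []))
      ; in₂out₂ = λ h₁ h₂ t₁ t₂ n₁ n₂ → 4≰3 (few-arcs _ _ ((n₁ ∷ []) ∷ [] ∷ []) ((n₂ ∷ []) ∷ [] ∷ [])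
          (h₁ ∷ h₂ ∷ []) (t₁ ∷ t₂ ∷ []))
      ; in₁out₃ = λ h t₁ t₂ t₃ n₁ n₂ n₃ → 4≰3 (few-arcs _ _ ([] ∷ []) ((n₁ ∷ n₂ ∷ []) ∷ (n₃ ∷ []) ∷ [] ∷ [])
          (h ∷ []) (t₁ ∷ t₂ ∷ t₃ ∷ []))
      }
      where
      4≰3 : ¬ 4 ≤ 3
      4≰3 (s≤s (s≤s (s≤s ())))

    triangle-free : GirthAtLeast 4 D → ∀ α β γ → head D α ≡ tail D β → head D β ≡ tail D γ → head D γ ≢ tail D α
    -- The index of `CycleIn` is one less than the length, so `2` stands for a triangle.
    triangle-free girth α β γ p q r = 4≰3 (girth 2 record
      { v = lookup (tail D α ∷ tail D β ∷ tail D γ ∷ [])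
      ; vInj = lookup-injective (((λ e → noLoop α (trans e (sym p))) ∷ (λ e → noLoop γ (sym (trans r e))) ∷ [])
                                 ∷ ((λ e → noLoop β (trans e (sym q))) ∷ []) ∷ [] ∷ [])
      ; c = lookup (α ∷ β ∷ γ ∷ [])
      ; cTail = λ { zero → refl ; (suc zero) → refl ; (suc (suc zero)) → refl }
      ; cHead = λ { zero → p ; (suc zero) → q ; (suc (suc zero)) → r }
      ; cP = λ _ → tt })
      where
      4≰3 : ¬ 4 ≤ 3
      4≰3 (s≤s (s≤s (s≤s ())))

    square-free : GirthAtLeast 5 D → ∀ α β γ δ → head D α ≡ tail D β → head D β ≡ tail D γ → head D γ ≡ tail D δ →
      head D δ ≢ tail D α
    square-free girth α β γ δ p q r s = 5≰4 (girth 3 record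
      { v = lookup (tail D α ∷ tail D β ∷ tail D γ ∷ tail D δ ∷ [])
      ; vInj = lookup-injective
          -- Adjacent corners differ because there are no loops; equal opposite corners would make
          -- two consecutive arcs a directed 2-cycle.
          (((λ e → noLoop α (trans e (sym p))) ∷ (λ e → no2cyc α β (trans e (sym q)) p)
             ∷ (λ e → noLoop δ (sym (trans s e))) ∷ [])
           ∷ ((λ e → noLoop β (trans e (sym q))) ∷ (λ e → no2cyc β γ (trans e (sym r)) q) ∷ [])
           ∷ ((λ e → noLoop γ (trans e (sym r))) ∷ []) ∷ [] ∷ [])
      ; c = lookup (α ∷ β ∷ γ ∷ δ ∷ [])
      ; cTail = λ { zero → refl ; (suc zero) → refl ; (suc (suc zero)) → refl ; (suc (suc (suc zero))) → refl }
      ; cHead = λ { zero → p ; (suc zero) → q ; (suc (suc zero)) → r ; (suc (suc (suc zero))) → s }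
      ; cP = λ _ → tt })
      where
      5≰4 : ¬ 5 ≤ 4
      5≰4 (s≤s (s≤s (s≤s (s≤s ()))))

    open Colouring (tail D) (head D) subcubic

    girth-weaken : ∀ {g h} → g ≤ h → GirthAtLeast h D → GirthAtLeast g D
    girth-weaken g≤h girth k C = ℕ.≤-trans g≤h (girth k C)

    fasd≥3 : PartitionFAS D 3
    fasd≥3 = good⇒partition (Induction.colour (λ sink source R → Step.three-step sink source R) _ (<-wellFounded _))

    module _ {P} (sink : NoSink P) (source : NoSource P) (R : Root P) where

      open Step sink source R

      root-triangle-free : GirthAtLeast 4 D → ∀ {α β} → Enters α → Leaves β → head D β ≢ tail D α
      root-triangle-free girth {α} {β} (_ , h) (_ , t) eq =
        triangle-free girth (Root.r R) β α (sym t) eq h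

      root-square-free : GirthAtLeast 5 D → ∀ {α β} → Enters α → Leaves β → ∀ γ → tail D γ ≡ head D β → head D γ ≢ tail D α
      root-square-free girth {α} {β} (_ , h) (_ , t) γ tγ hγ =
        square-free girth (Root.r R) β γ α (sym t) (sym tγ) hγ h

    fasd≥4 : GirthAtLeast 4 D → PartitionFAS D 4
    fasd≥4 girth = good⇒partition (Induction.colour
      (λ sink source R → Step.four-step sink source R (root-triangle-free sink source R girth)) _ (<-wellFounded _))

    fasd≥5 : GirthAtLeast 5 D → PartitionFAS D 5
    fasd≥5 girth = good⇒partition (Induction.colour
      (λ sink source R → Step.five-step sink source R
        (root-triangle-free sink source R (girth-weaken (ℕ.n≤1+n 4) girth)) (root-square-free sink source R girth))
      _ (<-wellFounded _))

-- The upper bound from the directed cycle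

directedCycle : ℕ → Digraph
directedCycle k = record { n = suc k ; m = suc k ; tail = id ; head = next }

-- The one arithmetic fact behind the admissibility of the directed cycle. It is decidable for each
-- `k` and is settled by evaluation for the three lengths in question.
RotationsMove : ℕ → Set
RotationsMove k = ∀ (j : Fin k) (i : Fin (suc k)) → rotate (suc (toℕ j)) i ≢ i

directedCycle-admissible : ∀ {k} → 2 ≤ k → RotationsMove k → MaxDegreeAtMost 3 (directedCycle k) →
  Admissible 3 (suc k) (directedCycle k)
directedCycle-admissible {suc zero} (s≤s ())
directedCycle-admissible {suc (suc k)} _ moves deg = oriented , deg , girth
  where
  oriented : Oriented (directedCycle (2 + k))
  oriented = record
    { noLoop = λ i eq → moves zero i (sym eq)
    ; noMulti = λ _ _ eq _ → eq
    ; no2cyc = λ i j p q → moves (suc zero) i (trans (cong next q) (sym p)) }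
  girth : GirthAtLeast (3 + k) (directedCycle (2 + k))
  girth l C with suc l ℕ.<? 3 + k
  ... | no l≮ = ℕ.≮⇒≥ l≮
  -- The map `v` commutes with rotation, so a shorter cycle would give a vertex fixed by `suc l`
  -- rotation steps.
  ... | yes (s≤s l<) = ⊥-elim (moves (fromℕ< l<) (v zero)
      (trans (cong (λ j → rotate (suc j) (v zero)) (toℕ-fromℕ< l<))
        (trans (sym (v-rotate (suc l) zero)) (cong v (rotate-full zero)))))
    where
    open CycleIn C
    v-rotate : ∀ j i → v (rotate j i) ≡ rotate j (v i)
    v-rotate zero    i = refl
    v-rotate (suc j) i = trans (v-rotate j (next i)) (cong (rotate j) (trans (sym (cHead i)) (cong next (cTail i))))

-- Each colour occurs on some arc, as otherwise the whole cycle would survive the removal of its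
-- class. Choosing one arc per colour embeds the colours into the arcs.
directedCycle-fasd≤ : ∀ k s → PartitionFAS (directedCycle k) s → s ≤ suc k
directedCycle-fasd≤ k s (col , fas) = injective⇒≤ {f = λ c → proj₁ (used c)}
  λ {c} {d} eq → trans (sym (proj₂ (used c))) (trans (cong col eq) (proj₂ (used d)))
  where
  used : ∀ c → ∃ λ a → col a ≡ c
  used c with any? (λ a → col a ≟ c)
  ... | yes w = w
  ... | no unused = ⊥-elim (fas c k record
    { v = id ; vInj = id ; c = id ; cTail = λ _ → refl ; cHead = λ _ → refl ; cP = λ a eq → unused (a , eq) })

fasd-eq : ∀ {k} → 2 ≤ k → RotationsMove k → MaxDegreeAtMost 3 (directedCycle k) →
  (∀ D → Admissible 3 (suc k) D → PartitionFAS D (suc k)) → FasdΔgEq 3 (suc k) (suc k)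
fasd-eq {k} 2≤k moves deg lower =
  lower , directedCycle k , admissible , lower _ admissible , directedCycle-fasd≤ k
  where admissible = directedCycle-admissible 2≤k moves deg

rotationsMove? : ∀ k → Dec (RotationsMove k)
rotationsMove? k = all? λ j → all? λ i → ¬? (rotate (suc (toℕ j)) i ≟ i)

maxDegree? : ∀ Δ D → Dec (MaxDegreeAtMost Δ D)
maxDegree? Δ D = all? λ v → deg D v ℕ.≤? Δ

theorem2 : ∀ (g : ℕ) → 3 ≤ g → g ≤ 5 → FasdΔgEq 3 g g
theorem2 (suc (suc (suc zero))) _ _ =
  fasd-eq (s≤s (s≤s z≤n)) (from-yes (rotationsMove? 2)) (from-yes (maxDegree? 3 (directedCycle 2)))
    λ D (orient , deg≤3 , _) → fasd≥3 D orient deg≤3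
theorem2 (suc (suc (suc (suc zero)))) _ _ =
  fasd-eq (s≤s (s≤s z≤n)) (from-yes (rotationsMove? 3)) (from-yes (maxDegree? 3 (directedCycle 3)))
    λ D (orient , deg≤3 , girth) → fasd≥4 D orient deg≤3 girth
theorem2 (suc (suc (suc (suc (suc zero))))) _ _ =
  fasd-eq (s≤s (s≤s z≤n)) (from-yes (rotationsMove? 4)) (from-yes (maxDegree? 3 (directedCycle 4)))
    λ D (orient , deg≤3 , girth) → fasd≥5 D orient deg≤3 girth
theorem2 (suc zero) (s≤s ()) _
theorem2 (suc (suc zero)) (s≤s (s≤s ())) _
theorem2 (suc (suc (suc (suc (suc (suc _)))))) _ (s≤s (s≤s (s≤s (s≤s (s≤s ())))))
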